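{- Let $m,n,s,k$ be integers such that $3\leqslant s\leqslant n$, $3\leqslant k\leqslant m$, $ms=nk$ and $nk\equiv 0$ or $3 \pmod 4$. If $k$ is odd, $k\geqslant 7\cdot\gcd(k,s)$, and $s\notin\{3,5,6,10\}$, then there exists an integer Heffter array $\mathrm{H}(m,n;s,k)$.
   Context: An integer Heffter array $\mathrm{H}(m,n;s,k)$ is an $m\times n$ partially filled array whose entries are integers from $\{\pm1,\pm2,\ldots,\pm nk\}$ such that: each row contains exactly $s$ filled cells and each column contains exactly $k$ filled cells; no two entries have the same absolute value; and the entries of every row and of every column sum to $0$. -}

module Defs where

open import Data.Integer.Base using (ℤ; 0ℤ; ∣_∣) renaming (_+_ to _+ℤ_)
open import Data.List.Base using (List; catMaybes; foldr; length)
open import Data.Maybe.Base using (Maybe; just)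
open import Data.Nat.Base using (ℕ; _*_; _≤_)
open import Data.Product.Base using (_×_)
open import Data.Vec.Functional using (Vector; toList; transpose)
open import Relation.Binary.PropositionalEquality.Core using (_≡_)

-- m rows and n columns; `nothing` is an empty cell.
PartialArray : ℕ → ℕ → Set
PartialArray m n = Vector (Vector (Maybe ℤ) n) m

entries : ∀ {n} → Vector (Maybe ℤ) n → List ℤ
entries v = catMaybes (toList v)

sumℤ : List ℤ → ℤ
sumℤ = foldr _+ℤ_ 0ℤ

record IsHeffter {m n : ℕ} (s k : ℕ) (A : PartialArray m n) : Set where
  field
    -- every entry lies in {±1, …, ±nk}
    range      : ∀ i j {x} → A i j ≡ just x → 1 ≤ ∣ x ∣ × ∣ x ∣ ≤ n * k
    row-filled : ∀ i → length (entries (A i)) ≡ s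
    col-filled : ∀ j → length (entries (transpose A j)) ≡ k
    -- entries in distinct cells have distinct absolute values
    distinct   : ∀ i j i′ j′ {x y} → A i j ≡ just x → A i′ j′ ≡ just y →
                 ∣ x ∣ ≡ ∣ y ∣ → i ≡ i′ × j ≡ j′
    row-sum    : ∀ i → sumℤ (entries (A i)) ≡ 0ℤ
    col-sum    : ∀ j → sumℤ (entries (transpose A j)) ≡ 0ℤ

record H (m n s k : ℕ) : Set where
  field
    array     : PartialArray m n
    isHeffter : IsHeffter s k array

{-# OPTIONS --safe #-}
-- Let g = gcd k s, k = g a and s = g t.  Coprimality of a and t gives m = c a and n = c t with c ≥ g,
-- so it suffices to find c full a × s arrays with zero line sums whose entries have the absolute
-- values 1, …, c a s, each once, and to spread each of them over g cyclically consecutive block columns.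
--
-- Each of these arrays is cut into strips of 3 and of 4 rows, and the strips into 3 × 4, 3 × 7, 3 × 9,
-- 4 × 3 and 4 × 4 arrays.  The 4 × 4 arrays have balanced signs, so that they can take their entries
-- from any 16 consecutive integers.  The columns of the 3-row arrays are triples x, y, -(x + y), as in
-- Skolem's problem: x runs through consecutive integers, and the pairs (y, x + y) are nested around one
-- centre for x even and around another one for x odd.  In 4, 7 or 9 consecutive columns, the rows can be
-- made to sum to zero whatever the centres are, by a choice of signs and of the order in each column.
-- Skolem sequences need an order congruent to 0 or 1 mod 4; accordingly the columns are split into
-- two runs of nearly equal length, and one or two further arrays fill the gaps that the two runs leave.
module Submission where

open import Defs
open import Algebra.Properties.CommutativeSemigroup using (interchange)
open import Data.Fin.Base as Fin using (Fin; zero; suc; toℕ; splitAt; _↑ˡ_; _↑ʳ_; combine; remQuot)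
open import Data.Fin.Patterns using (1F; 2F; 3F; 4F; 5F)
import Data.Fin.Properties as Fin
open import Data.Integer.Base as ℤ using (ℤ; 0ℤ; ∣_∣; _◃_; -[1+_])
import Data.Integer.Properties as ℤ
open import Data.List.Base as List using (List; []; _∷_; _++_; [_]; tabulate; catMaybes; applyUpTo; length)
import Data.List.Properties as List
open import Data.List.Membership.Propositional using (_∈_; _∉_)
open import Data.List.Membership.Propositional.Properties using (∈-++⁺ˡ; ∈-++⁺ʳ)
open import Data.List.Relation.Binary.Permutation.Propositional as ↭
  using (_↭_; ↭-refl; ↭-reflexive; ↭-sym; ↭-trans; prep; ↭⇒↭ₛ; module PermutationReasoning)
import Data.List.Relation.Binary.Permutation.Propositional.Properties as ↭
import Data.List.Relation.Binary.Permutation.Setoid.Properties as ↭ₛ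
open import Data.List.Relation.Unary.All as All using (All; []; _∷_)
import Data.List.Relation.Unary.All.Properties as All
open import Data.List.Relation.Unary.AllPairs using ([]; _∷_)
open import Data.List.Relation.Unary.Any using (here; there)
open import Data.List.Relation.Unary.Unique.Propositional using (Unique)
open import Data.List.Relation.Unary.Unique.Propositional.Properties using (allFin⁺)
open import Data.Maybe.Base as Maybe using (Maybe; just; nothing; from-just)
open import Data.Nat.Base using (ℕ; zero; suc; _+_; _*_; _/_; _%_; _≤_; _<_; _≥_; NonZero; z≤n; s≤s; s≤s⁻¹)
open import Data.Nat.Coprimality using (Coprime; coprime-divisor)
open import Data.Nat.Divisibility
  using (_∣_; divides; ∣-trans; ∣1⇒≡1; ∣m⇒∣m*n; n∣m*n; ∣m∣n⇒∣m+n; ∣m+n∣m⇒∣n; *-monoˡ-∣; *-cancelʳ-∣; m%n≡0⇒n∣m)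
open import Data.Nat.DivMod
  using (_mod_; m≡m%n+[m/n]*n; m%n<n; m<n⇒m%n≡m; [m+n]%n≡m%n; [m+kn]%n≡m%n; %-distribˡ-*)
open import Data.Nat.GCD using (gcd; gcd-greatest; gcd[m,n]≢0; gcd[m,n]∣m; gcd[m,n]∣n)
open import Data.Nat.ListAction using (sum)
open import Data.Nat.ListAction.Properties using (sum-↭)
import Data.Nat.Properties as ℕ
open import Data.Nat.Tactic.RingSolver using (solve-∀)
open import Data.Product.Base using (Σ; ∃; _×_; _,_; proj₂; uncurry)
import Data.Product.Properties as Product
open import Data.Sign.Base as Sign using (Sign)
open import Data.Sum.Base as Sum using (_⊎_; inj₁; inj₂; [_,_]′)
open import Data.Vec.Base as Vec using (Vec; []; _∷_; map; replicate; zipWith; foldr′; toList; transpose; lookup)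
import Data.Vec.Properties as Vec
import Data.Vec.Functional as Vector
open import Function.Base using (_∘_; id)
open import Relation.Binary.Definitions using (DecidableEquality)
open import Relation.Binary.PropositionalEquality
  using (_≡_; refl; sym; trans; cong; cong₂; subst; subst₂; setoid; module ≡-Reasoning)
open import Relation.Nullary.Decidable using (yes; no)
open import Relation.Nullary.Negation using (¬_; contradiction)

private variable
  A B : Set
  r r′ c c′ m n d w : ℕ

-- Zero-sum arrays

Mat : Set → ℕ → ℕ → Set
Mat A r c = Vec (Vec A c) r

-- No laws are assumed of the operation, since the same sums are taken of integers and of linear
-- forms.
module LineSums {A : Set} (_∙_ : A → A → A) (ε : A) where

  rowSums : Mat A r c → Vec A r
  rowSums = map (foldr′ _∙_ ε)

  colSums : Mat A r c → Vec A c
  colSums = foldr′ (zipWith _∙_) (replicate _ ε)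

  private
    prepend : Vec A r → Mat A r c → Mat A r (suc c)
    prepend = zipWith _∷_

    rowSums-prepend : (v : Vec A r) (M : Mat A r c) →
                      rowSums (prepend v M) ≡ zipWith _∙_ v (rowSums M)
    rowSums-prepend []      []      = refl
    rowSums-prepend (x ∷ v) (w ∷ M) = cong (_ ∷_) (rowSums-prepend v M)

    colSums-prepend : (v : Vec A r) (M : Mat A r c) →
                      colSums (prepend v M) ≡ foldr′ _∙_ ε v ∷ colSums M
    colSums-prepend []      []      = refl
    colSums-prepend (x ∷ v) (w ∷ M) = cong (zipWith _∙_ (x ∷ w)) (colSums-prepend v M)

    transpose-∷ : (v : Vec A c) (M : Mat A r c) → transpose (v ∷ M) ≡ prepend v (transpose M)
    transpose-∷ v M = sym (Vec.zipWith-is-⊛ _∷_ v (transpose M))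

  rowSums-transpose : (M : Mat A r c) → rowSums (transpose M) ≡ colSums M
  rowSums-transpose {c = c} [] = Vec.map-replicate _ [] c
  rowSums-transpose (v ∷ M) = begin
    rowSums (transpose (v ∷ M))           ≡⟨ cong rowSums (transpose-∷ v M) ⟩
    rowSums (prepend v (transpose M))     ≡⟨ rowSums-prepend v (transpose M) ⟩
    zipWith _∙_ v (rowSums (transpose M)) ≡⟨ cong (zipWith _∙_ v) (rowSums-transpose M) ⟩
    zipWith _∙_ v (colSums M)             ∎
    where open ≡-Reasoning

  colSums-replicate-[] : ∀ n → colSums (replicate n []) ≡ []
  colSums-replicate-[] n with [] ← colSums (replicate n []) = refl

  colSums-transpose : (M : Mat A r c) → colSums (transpose M) ≡ rowSums M
  colSums-transpose {c = c} [] = colSums-replicate-[] c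
  colSums-transpose (v ∷ M) = begin
    colSums (transpose (v ∷ M))                   ≡⟨ cong colSums (transpose-∷ v M) ⟩
    colSums (prepend v (transpose M))             ≡⟨ colSums-prepend v (transpose M) ⟩
    foldr′ _∙_ ε v ∷ colSums (transpose M)        ≡⟨ cong (_ ∷_) (colSums-transpose M) ⟩
    rowSums (v ∷ M)                               ∎
    where open ≡-Reasoning

module _ {A B : Set} {_∙_ : A → A → A} {ε : A} {_◦_ : B → B → B} {η : B} (f : A → B)
         (ε-homo : f ε ≡ η) (∙-homo : ∀ x y → f (x ∙ y) ≡ f x ◦ f y) where

  private
    module A = LineSums _∙_ ε
    module B = LineSums _◦_ η

    foldr-homo : (v : Vec A n) → f (foldr′ _∙_ ε v) ≡ foldr′ _◦_ η (map f v)
    foldr-homo []      = ε-homo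
    foldr-homo (x ∷ v) = trans (∙-homo x _) (cong (f x ◦_) (foldr-homo v))

    zipWith-homo : (v w : Vec A n) → map f (zipWith _∙_ v w) ≡ zipWith _◦_ (map f v) (map f w)
    zipWith-homo []      []      = refl
    zipWith-homo (x ∷ v) (y ∷ w) = cong₂ _∷_ (∙-homo x y) (zipWith-homo v w)

  -- Applied to the evaluation of linear forms at a point: sums that vanish as forms then vanish at
  -- every point.
  rowSums-homo : (M : Mat A r c) → B.rowSums (map (map f) M) ≡ map f (A.rowSums M)
  rowSums-homo []      = refl
  rowSums-homo (v ∷ M) = cong₂ _∷_ (sym (foldr-homo v)) (rowSums-homo M)

  colSums-homo : (M : Mat A r c) → B.colSums (map (map f) M) ≡ map f (A.colSums M)
  colSums-homo {c = c} [] = trans (cong (replicate c) (sym ε-homo)) (sym (Vec.map-replicate f ε c))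
  colSums-homo (v ∷ M) = begin
    zipWith _◦_ (map f v) (B.colSums (map (map f) M)) ≡⟨ cong (zipWith _◦_ (map f v)) (colSums-homo M) ⟩
    zipWith _◦_ (map f v) (map f (A.colSums M))       ≡⟨ zipWith-homo v (A.colSums M) ⟨
    map f (zipWith _∙_ v (A.colSums M))               ∎
    where open ≡-Reasoning

open LineSums ℤ._+_ 0ℤ

rowLabels : Vec ℤ c → List ℕ
rowLabels = toList ∘ map ∣_∣

matLabels : Mat ℤ r c → List ℕ
matLabels = List.concat ∘ toList ∘ map rowLabels

matLabels-prepend : (v : Vec ℤ r) (M : Mat ℤ r c) →
               matLabels (zipWith _∷_ v M) ↭ rowLabels v ++ matLabels M
matLabels-prepend []      []      = ↭-refl
matLabels-prepend (x ∷ v) (w ∷ M) = prep ∣ x ∣ (begin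
  rowLabels w ++ matLabels (zipWith _∷_ v M)   ↭⟨ ↭.++⁺ˡ (rowLabels w) (matLabels-prepend v M) ⟩
  rowLabels w ++ rowLabels v ++ matLabels M    ↭⟨ ↭.shifts (rowLabels w) (rowLabels v) ⟩
  rowLabels v ++ rowLabels w ++ matLabels M    ∎)
  where open PermutationReasoning

matLabels-transpose : (M : Mat ℤ r c) → matLabels (transpose M) ↭ matLabels M
matLabels-transpose {c = zero}  []      = ↭-refl
matLabels-transpose {c = suc c} []      = matLabels-transpose {c = c} []
matLabels-transpose (v ∷ M) = begin
  matLabels (transpose (v ∷ M))            ≡⟨ cong matLabels (Vec.zipWith-is-⊛ _∷_ v (transpose M)) ⟨
  matLabels (zipWith _∷_ v (transpose M))  ↭⟨ matLabels-prepend v (transpose M) ⟩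
  rowLabels v ++ matLabels (transpose M)   ↭⟨ ↭.++⁺ˡ (rowLabels v) (matLabels-transpose M) ⟩
  rowLabels v ++ matLabels M               ∎
  where open PermutationReasoning

record Array (r c : ℕ) : Set where
  constructor mkArray
  field
    cells     : Mat ℤ r c
    rows-zero : rowSums cells ≡ replicate r 0ℤ
    cols-zero : colSums cells ≡ replicate c 0ℤ

open Array public

labels : Array r c → List ℕ
labels = matLabels ∘ cells

allLabels : Vec (Array r c) n → List ℕ
allLabels = List.concat ∘ toList ∘ map labels

_ᵀ : Array r c → Array c r
(mkArray M rz cz) ᵀ = mkArray (transpose M) (trans (rowSums-transpose M) cz)
                                            (trans (colSums-transpose M) rz)

labels-ᵀ : (A : Array r c) → labels (A ᵀ) ↭ labels A
labels-ᵀ A = matLabels-transpose (cells A)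

matLabels-++ : (M : Mat ℤ r c) (N : Mat ℤ r′ c) →
               matLabels (M Vec.++ N) ≡ matLabels M ++ matLabels N
matLabels-++ []      N = refl
matLabels-++ (v ∷ M) N =
  trans (cong (rowLabels v ++_) (matLabels-++ M N)) (sym (List.++-assoc (rowLabels v) _ _))

replicate-++ : ∀ m n {A : Set} {x : A} → replicate m x Vec.++ replicate n x ≡ replicate (m + n) x
replicate-++ zero    n = refl
replicate-++ (suc m) n = cong (_ ∷_) (replicate-++ m n)

zipWith-+-zeros : (v : Vec ℤ n) → zipWith ℤ._+_ (replicate n 0ℤ) v ≡ v
zipWith-+-zeros []      = refl
zipWith-+-zeros (x ∷ v) = cong₂ _∷_ (ℤ.+-identityˡ x) (zipWith-+-zeros v)

above : Array r c → Array r′ c → Array (r + r′) c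
above {r} {c} {r′} (mkArray M rz cz) (mkArray N rz′ cz′) = mkArray (M Vec.++ N) rows (cols M cz)
  where
  rows : rowSums (M Vec.++ N) ≡ replicate (r + r′) 0ℤ
  rows = trans (Vec.map-++ _ M N) (trans (cong₂ Vec._++_ rz rz′) (replicate-++ r r′))
  colSums-++ : ∀ {r} (M : Mat ℤ r c) →
               colSums (M Vec.++ N) ≡ zipWith ℤ._+_ (colSums M) (colSums N)
  colSums-++ []      = sym (zipWith-+-zeros (colSums N))
  colSums-++ (v ∷ M) = trans (cong (zipWith ℤ._+_ v) (colSums-++ M))
                             (sym (Vec.zipWith-assoc ℤ.+-assoc v (colSums M) (colSums N)))
  cols : ∀ {r} (M : Mat ℤ r c) → colSums M ≡ replicate c 0ℤ →
         colSums (M Vec.++ N) ≡ replicate c 0ℤ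
  cols M cz = trans (colSums-++ M) (trans (cong (λ v → zipWith ℤ._+_ v (colSums N)) cz)
                (trans (zipWith-+-zeros _) cz′))

stack : Vec (Array r c) n → Array (n * r) c
stack {c = c} []       = mkArray [] refl refl
stack         (A ∷ As) = above A (stack As)

labels-stack : (As : Vec (Array r c) n) → labels (stack As) ≡ allLabels As
labels-stack []       = refl
labels-stack (A ∷ As) = trans (matLabels-++ (cells A) _) (cong (labels A ++_) (labels-stack As))

allLabels-ᵀ : (As : Vec (Array r c) n) → allLabels (map _ᵀ As) ↭ allLabels As
allLabels-ᵀ []       = ↭-refl
allLabels-ᵀ (A ∷ As) = ↭.++⁺ (labels-ᵀ A) (allLabels-ᵀ As)

-- Transposition reduces juxtaposition to stacking, so that line sums of a composite are computed
-- only for `above`.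
row : Vec (Array r c) n → Array r (n * c)
row As = stack (map _ᵀ As) ᵀ

labels-row : (As : Vec (Array r c) n) → labels (row As) ↭ allLabels As
labels-row As = ↭-trans (labels-ᵀ (stack (map _ᵀ As)))
                  (↭-trans (↭-reflexive (labels-stack (map _ᵀ As))) (allLabels-ᵀ As))

beside : Array r c → Array r c′ → Array r (c + c′)
beside A B = above (A ᵀ) (B ᵀ) ᵀ

labels-above : (A : Array r c) (B : Array r′ c) → labels (above A B) ≡ labels A ++ labels B
labels-above A B = matLabels-++ (cells A) (cells B)

labels-beside : (A : Array r c) (B : Array r c′) → labels (beside A B) ↭ labels A ++ labels B
labels-beside A B = ↭-trans (labels-ᵀ (above (A ᵀ) (B ᵀ)))
  (↭-trans (↭-reflexive (labels-above (A ᵀ) (B ᵀ))) (↭.++⁺ (labels-ᵀ A) (labels-ᵀ B)))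

allLabels-++ : ∀ {m} (As : Vec (Array r c) n) (Bs : Vec (Array r c) m) →
               allLabels (As Vec.++ Bs) ≡ allLabels As ++ allLabels Bs
allLabels-++ []       Bs = refl
allLabels-++ (A ∷ As) Bs = trans (cong (labels A ++_) (allLabels-++ As Bs))
                                 (sym (List.++-assoc (labels A) _ _))

-- Distributing small arrays among larger ones

module _ {r₁ c₁ r₂ c₂ r c p q : ℕ}
         (build : (As : Vec (Array r₁ c₁) p) (Bs : Vec (Array r₂ c₂) q) →
                  Σ (Array r c) λ C → labels C ↭ allLabels As ++ allLabels Bs) where

  -- Serves three times: to form strips of 3 rows, strips of 4 rows, and full arrays from strips.
  -- Labels are compared up to permutation only, so it does not matter which small array goes where.
  portions : ∀ n (As : Vec (Array r₁ c₁) (n * p)) (Bs : Vec (Array r₂ c₂) (n * q)) →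
             Σ (Vec (Array r c) n) λ Cs → allLabels Cs ↭ allLabels As ++ allLabels Bs
  portions zero    []  []  = [] , ↭-refl
  portions (suc n) As′ Bs′
    with As₁ , As₂ , refl ← Vec.splitAt p As′
       | Bs₁ , Bs₂ , refl ← Vec.splitAt q Bs′
    with C , eq ← build As₁ Bs₁ | Cs , eqs ← portions n As₂ Bs₂
    = C ∷ Cs , (begin
    labels C ++ allLabels Cs ↭⟨ ↭.++⁺ eq eqs ⟩
    (a₁ ++ b₁) ++ (a₂ ++ b₂) ≡⟨ List.++-assoc a₁ b₁ _ ⟩
    a₁ ++ b₁ ++ a₂ ++ b₂     ↭⟨ ↭.++⁺ˡ a₁ (↭.shifts b₁ a₂) ⟩
    a₁ ++ a₂ ++ b₁ ++ b₂     ≡⟨ List.++-assoc a₁ a₂ _ ⟨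
    (a₁ ++ a₂) ++ b₁ ++ b₂   ≡⟨ cong₂ _++_ (allLabels-++ As₁ As₂) (allLabels-++ Bs₁ Bs₂) ⟨
    allLabels (As₁ Vec.++ As₂) ++ allLabels (Bs₁ Vec.++ Bs₂) ∎)
    where
    open PermutationReasoning
    a₁ = allLabels As₁ ; a₂ = allLabels As₂ ; b₁ = allLabels Bs₁ ; b₂ = allLabels Bs₂

-- Search for permutations; intervals

module _ {A : Set} (_≟_ : DecidableEquality A) where

  extract? : (x : A) (ys : List A) → Maybe (∃ λ zs → x ∷ zs ↭ ys)
  extract? x []       = nothing
  extract? x (y ∷ ys) with x ≟ y
  ... | yes refl = just (ys , ↭-refl)
  ... | no _     = Maybe.map (λ (zs , p) → y ∷ zs , ↭-trans (↭.swap x y ↭-refl) (prep y p))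
                             (extract? x ys)

  -- Only success carries a proof. On closed lists the search evaluates during type checking, and
  -- `from-just` extracts the permutation.
  permutation? : (xs ys : List A) → Maybe (xs ↭ ys)
  permutation? []       []       = just ↭-refl
  permutation? []       (_ ∷ _)  = nothing
  permutation? (x ∷ xs) ys       =
    extract? x ys Maybe.>>= λ (zs , p) →
    Maybe.map (λ q → ↭-trans (prep x q) p) (permutation? xs zs)

concat-↭ : {xss yss : List (List A)} → xss ↭ yss → List.concat xss ↭ List.concat yss
concat-↭ ↭.refl           = ↭-refl
concat-↭ (prep xs p)      = ↭.++⁺ˡ xs (concat-↭ p)
concat-↭ (↭.swap xs ys p) = ↭-trans (↭.shifts xs ys) (↭.++⁺ˡ ys (↭.++⁺ˡ xs (concat-↭ p)))
concat-↭ (↭.trans p q)    = ↭-trans (concat-↭ p) (concat-↭ q)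

interval : ℕ → ℕ → List ℕ
interval s zero    = []
interval s (suc l) = s ∷ interval (suc s) l

interval-+ : ∀ s l l′ → interval s (l + l′) ≡ interval s l ++ interval (s + l) l′
interval-+ s zero    l′ = cong (λ t → interval t l′) (sym (ℕ.+-identityʳ s))
interval-+ s (suc l) l′ = cong (s ∷_)
  (trans (interval-+ (suc s) l l′)
         (cong (λ t → interval (suc s) l ++ interval t l′) (sym (ℕ.+-suc s l))))

-- Linear forms.  The constant term is the coefficient of a variable that is evaluated at 1.

Form : ℕ → Set
Form = Vec ℕ

_⊕_ : Form d → Form d → Form d
_⊕_ = zipWith _+_

⟦_⟧ : Form d → Vec ℕ d → ℕ
⟦ []    ⟧ []      = 0
⟦ a ∷ f ⟧ (x ∷ ρ) = a * x + ⟦ f ⟧ ρ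

⟦⊕⟧ : (f g : Form d) (ρ : Vec ℕ d) → ⟦ f ⊕ g ⟧ ρ ≡ ⟦ f ⟧ ρ + ⟦ g ⟧ ρ
⟦⊕⟧ []      []      []      = refl
⟦⊕⟧ (a ∷ f) (b ∷ g) (x ∷ ρ) = trans (cong₂ _+_ (ℕ.*-distribʳ-+ x a b) (⟦⊕⟧ f g ρ))
                                    (interchange ℕ.+-commutativeSemigroup (a * x) (b * x) _ _)

0ᶠ : Form d
0ᶠ = replicate _ 0

⟦0ᶠ⟧ : (ρ : Vec ℕ d) → ⟦ 0ᶠ ⟧ ρ ≡ 0
⟦0ᶠ⟧ []      = refl
⟦0ᶠ⟧ (x ∷ ρ) = ⟦0ᶠ⟧ ρ

-- Absolute values are forms with natural coefficients; integer coefficients are needed where signed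
-- entries of a line are to cancel.
SForm : ℕ → Set
SForm = Vec ℤ

signed : Sign × Form d → SForm d
signed (s , f) = map (s ◃_) f

⟦_⟧ˢ : SForm d → Vec ℕ d → ℤ
⟦ []    ⟧ˢ []      = 0ℤ
⟦ a ∷ f ⟧ˢ (x ∷ ρ) = a ℤ.* (ℤ.+ x) ℤ.+ ⟦ f ⟧ˢ ρ

⟦_⟧ᶜ : Sign × Form d → Vec ℕ d → ℤ
⟦ s , f ⟧ᶜ ρ = s ◃ ⟦ f ⟧ ρ

_⊕ˢ_ : SForm d → SForm d → SForm d
_⊕ˢ_ = zipWith ℤ._+_

0ˢ : SForm d
0ˢ = replicate _ 0ℤ

⟦0ˢ⟧ : (ρ : Vec ℕ d) → ⟦ 0ˢ ⟧ˢ ρ ≡ 0ℤ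
⟦0ˢ⟧ []      = refl
⟦0ˢ⟧ (x ∷ ρ) = trans (ℤ.+-identityˡ _) (⟦0ˢ⟧ ρ)

⟦⊕ˢ⟧ : (ρ : Vec ℕ d) (f g : SForm d) → ⟦ f ⊕ˢ g ⟧ˢ ρ ≡ ⟦ f ⟧ˢ ρ ℤ.+ ⟦ g ⟧ˢ ρ
⟦⊕ˢ⟧ []      []      []      = refl
⟦⊕ˢ⟧ (x ∷ ρ) (a ∷ f) (b ∷ g) =
  trans (cong₂ ℤ._+_ (ℤ.*-distribʳ-+ (ℤ.+ x) a b) (⟦⊕ˢ⟧ ρ f g))
        (interchange ℤ.+-commutativeSemigroup (a ℤ.* (ℤ.+ x)) (b ℤ.* (ℤ.+ x)) _ _)

◃-distrib-+ : ∀ s m n → s ◃ (m + n) ≡ (s ◃ m) ℤ.+ (s ◃ n)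
◃-distrib-+ Sign.+ m n = trans (ℤ.+◃n≡+n (m + n)) (sym (cong₂ ℤ._+_ (ℤ.+◃n≡+n m) (ℤ.+◃n≡+n n)))
◃-distrib-+ Sign.- m n = begin
  Sign.- ◃ (m + n)                  ≡⟨ ℤ.-◃n≡-n (m + n) ⟩
  ℤ.- ℤ.+ (m + n)                   ≡⟨ ℤ.neg-distrib-+ (ℤ.+ m) (ℤ.+ n) ⟩
  (ℤ.- ℤ.+ m) ℤ.+ (ℤ.- ℤ.+ n)       ≡⟨ cong₂ ℤ._+_ (ℤ.-◃n≡-n m) (ℤ.-◃n≡-n n) ⟨
  (Sign.- ◃ m) ℤ.+ (Sign.- ◃ n)     ∎
  where open ≡-Reasoning

◃-* : ∀ s m n → s ◃ (m * n) ≡ (s ◃ m) ℤ.* (ℤ.+ n)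
◃-* Sign.+ m n = trans (ℤ.+◃n≡+n (m * n))
  (trans (ℤ.pos-* m n) (cong (ℤ._* (ℤ.+ n)) (sym (ℤ.+◃n≡+n m))))
◃-* Sign.- m n = begin
  Sign.- ◃ (m * n)              ≡⟨ ℤ.-◃n≡-n (m * n) ⟩
  ℤ.- ℤ.+ (m * n)               ≡⟨ cong ℤ.-_ (ℤ.pos-* m n) ⟩
  ℤ.- (ℤ.+ m ℤ.* ℤ.+ n)         ≡⟨ ℤ.neg-distribˡ-* (ℤ.+ m) (ℤ.+ n) ⟩
  (ℤ.- ℤ.+ m) ℤ.* ℤ.+ n         ≡⟨ cong (ℤ._* (ℤ.+ n)) (ℤ.-◃n≡-n m) ⟨
  (Sign.- ◃ m) ℤ.* ℤ.+ n        ∎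
  where open ≡-Reasoning

⟦signed⟧ : (ρ : Vec ℕ d) (e : Sign × Form d) → ⟦ signed e ⟧ˢ ρ ≡ ⟦ e ⟧ᶜ ρ
⟦signed⟧ []      (Sign.+ , []) = refl
⟦signed⟧ []      (Sign.- , []) = refl
⟦signed⟧ (x ∷ ρ) (s , a ∷ f)   = trans
  (cong₂ ℤ._+_ (sym (◃-* s a x)) (⟦signed⟧ ρ (s , f)))
  (sym (◃-distrib-+ s (a * x) _))

-- The sums are zero coefficient by coefficient, so that a computation on closed data proves them
-- zero for all values of the variables.
record FormArray (d r c : ℕ) : Set where
  constructor formArray
  field
    entry     : Mat (Sign × Form d) r c
    rows-zero : LineSums.rowSums _⊕ˢ_ 0ˢ (map (map signed) entry) ≡ replicate r 0ˢ
    cols-zero : LineSums.colSums _⊕ˢ_ 0ˢ (map (map signed) entry) ≡ replicate c 0ˢ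

open FormArray using (entry)

evaluate : Vec ℕ d → FormArray d r c → Array r c
evaluate {d} {r} {c} ρ (formArray M rz cz) = mkArray (map (map (λ e → ⟦ e ⟧ᶜ ρ)) M)
  (zero-lines Z.rowSums S.rowSums rz (rowSums-homo ⟦_⟧ρ (⟦0ˢ⟧ ρ) (⟦⊕ˢ⟧ ρ)))
  (zero-lines Z.colSums S.colSums cz (colSums-homo ⟦_⟧ρ (⟦0ˢ⟧ ρ) (⟦⊕ˢ⟧ ρ)))
  where
  module Z = LineSums ℤ._+_ 0ℤ
  module S = LineSums (_⊕ˢ_ {d}) 0ˢ
  ⟦_⟧ρ : SForm d → ℤ
  ⟦ f ⟧ρ = ⟦ f ⟧ˢ ρ
  via-signed : map (map ⟦_⟧ρ) (map (map signed) M) ≡ map (map (λ e → ⟦ e ⟧ᶜ ρ)) M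
  via-signed = trans (sym (Vec.map-∘ (map ⟦_⟧ρ) (map signed) M))
    (Vec.map-cong (λ v → trans (sym (Vec.map-∘ ⟦_⟧ρ signed v)) (Vec.map-cong (⟦signed⟧ ρ) v)) M)
  zero-lines : ∀ {l} (sums : Mat ℤ r c → Vec ℤ l) (sumsˢ : Mat (SForm d) r c → Vec (SForm d) l) →
    sumsˢ (map (map signed) M) ≡ replicate l 0ˢ →
    (∀ N → sums (map (map ⟦_⟧ρ) N) ≡ map ⟦_⟧ρ (sumsˢ N)) →
    sums (map (map (λ e → ⟦ e ⟧ᶜ ρ)) M) ≡ replicate l 0ℤ
  zero-lines {l} sums sumsˢ z homo = begin
    sums (map (map (λ e → ⟦ e ⟧ᶜ ρ)) M)           ≡⟨ cong sums via-signed ⟨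
    sums (map (map ⟦_⟧ρ) (map (map signed) M))    ≡⟨ homo (map (map signed) M) ⟩
    map ⟦_⟧ρ (sumsˢ (map (map signed) M))         ≡⟨ cong (map ⟦_⟧ρ) z ⟩
    map ⟦_⟧ρ (replicate l 0ˢ)                     ≡⟨ Vec.map-replicate ⟦_⟧ρ 0ˢ l ⟩
    replicate l (⟦ 0ˢ ⟧ρ)                         ≡⟨ cong (replicate l) (⟦0ˢ⟧ ρ) ⟩
    replicate l 0ℤ                                ∎
    where open ≡-Reasoning

-- Intervals whose start and length are linear forms

Span : ℕ → Set
Span d = Form d × Form d

⟦_⟧ⁱ : Span d → Vec ℕ d → List ℕ
⟦ s , l ⟧ⁱ ρ = interval (⟦ s ⟧ ρ) (⟦ l ⟧ ρ)

⟦_⟧* : List (Span d) → Vec ℕ d → List ℕ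
⟦ is ⟧* ρ = List.concat (List.map (λ i → ⟦ i ⟧ⁱ ρ) is)

constant : ℕ → Form (suc d)
constant k = k ∷ 0ᶠ

-- Each span starts where the preceding one ends; a cut of an interval is thus given by lengths
-- alone.
tile : Form d → List (Form d) → List (Span d)
tile s []       = []
tile s (l ∷ ls) = (s , l) ∷ tile (s ⊕ l) ls

⟦tile⟧ : (ρ : Vec ℕ d) (s : Form d) (ls : List (Form d)) →
         ⟦ tile s ls ⟧* ρ ≡ interval (⟦ s ⟧ ρ) (⟦ List.foldr _⊕_ 0ᶠ ls ⟧ ρ)
⟦tile⟧ ρ s []       = cong (interval (⟦ s ⟧ ρ)) (sym (⟦0ᶠ⟧ ρ))
⟦tile⟧ ρ s (l ∷ ls) = begin
  ⟦ s , l ⟧ⁱ ρ ++ ⟦ tile (s ⊕ l) ls ⟧* ρ       ≡⟨ cong (⟦ s , l ⟧ⁱ ρ ++_) (⟦tile⟧ ρ (s ⊕ l) ls) ⟩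
  ⟦ s , l ⟧ⁱ ρ ++ interval (⟦ s ⊕ l ⟧ ρ) rest  ≡⟨ cong (λ t → ⟦ s , l ⟧ⁱ ρ ++ interval t rest) (⟦⊕⟧ s l ρ) ⟩
  ⟦ s , l ⟧ⁱ ρ ++ interval (⟦ s ⟧ ρ + ⟦ l ⟧ ρ) rest ≡⟨ interval-+ (⟦ s ⟧ ρ) (⟦ l ⟧ ρ) rest ⟨
  interval (⟦ s ⟧ ρ) (⟦ l ⟧ ρ + rest)          ≡⟨ cong (interval (⟦ s ⟧ ρ)) (⟦⊕⟧ l _ ρ) ⟨
  interval (⟦ s ⟧ ρ) (⟦ l ⊕ List.foldr _⊕_ 0ᶠ ls ⟧ ρ) ∎
  where
  open ≡-Reasoning
  rest = ⟦ List.foldr _⊕_ 0ᶠ ls ⟧ ρ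

-- One permutation of spans, found by comparing coefficients, yields a permutation of numbers for
-- every value of the variables.
⟦↭⟧ : {is js : List (Span d)} (ρ : Vec ℕ d) → is ↭ js → ⟦ is ⟧* ρ ↭ ⟦ js ⟧* ρ
⟦↭⟧ ρ p = concat-↭ (↭.map⁺ (λ i → ⟦ i ⟧ⁱ ρ) p)

⟦++⟧ : (ρ : Vec ℕ d) (is js : List (Span d)) → ⟦ is ++ js ⟧* ρ ≡ ⟦ is ⟧* ρ ++ ⟦ js ⟧* ρ
⟦++⟧ ρ []       js = refl
⟦++⟧ ρ (i ∷ is) js = trans (cong (⟦ i ⟧ⁱ ρ ++_) (⟦++⟧ ρ is js)) (sym (List.++-assoc (⟦ i ⟧ⁱ ρ) _ _))

-- Single cells become spans of length 1, so that they can be matched together with the long spans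
-- of a run.
points : FormArray (suc d) r c → List (Span (suc d))
points = List.concat ∘ toList ∘ map (toList ∘ map (λ (_ , f) → f , constant 1)) ∘ entry

⟦points⟧ : (ρ : Vec ℕ d) (A : FormArray (suc d) r c) →
           ⟦ points A ⟧* (1 ∷ ρ) ≡ labels (evaluate (1 ∷ ρ) A)
⟦points⟧ {d} ρ (formArray M _ _) = go M
  where
  goʳ : ∀ {c} (v : Vec (Sign × Form (suc d)) c) →
        ⟦ toList (map (λ (_ , f) → f , constant 1) v) ⟧* (1 ∷ ρ) ≡ rowLabels (map (λ e → ⟦ e ⟧ᶜ (1 ∷ ρ)) v)
  goʳ []            = refl
  goʳ ((s , f) ∷ v) rewrite ⟦0ᶠ⟧ ρ = cong₂ _∷_ (sym (ℤ.abs-◃ s _)) (goʳ v)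
  go : ∀ {r c} (M : Mat (Sign × Form (suc d)) r c) →
       ⟦ List.concat (toList (map (toList ∘ map (λ (_ , f) → f , constant 1)) M)) ⟧* (1 ∷ ρ) ≡
       matLabels (map (map (λ e → ⟦ e ⟧ᶜ (1 ∷ ρ))) M)
  go []      = refl
  go (v ∷ M) = trans (⟦++⟧ (1 ∷ ρ) (toList (map _ v)) _) (cong₂ _++_ (goʳ v) (go M))

_≟ⁱ_ : DecidableEquality (Span d)
_≟ⁱ_ = Product.≡-dec (Vec.≡-dec ℕ._≟_) (Vec.≡-dec ℕ._≟_)

var : Fin d → Form d
var zero    = 1 ∷ 0ᶠ
var (suc i) = 0 ∷ var i

⟦var⟧ : (i : Fin d) (ρ : Vec ℕ d) → ⟦ var i ⟧ ρ ≡ lookup ρ i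
⟦var⟧ zero    (x ∷ ρ) = trans (cong₂ _+_ (ℕ.*-identityˡ x) (⟦0ᶠ⟧ ρ)) (ℕ.+-identityʳ x)
⟦var⟧ (suc i) (x ∷ ρ) = ⟦var⟧ i ρ

⟦constant⟧ : ∀ k (ρ : Vec ℕ d) → ⟦ constant k ⟧ (1 ∷ ρ) ≡ k
⟦constant⟧ k ρ = trans (cong₂ _+_ (ℕ.*-identityʳ k) (⟦0ᶠ⟧ ρ)) (ℕ.+-identityʳ k)

-- Runs of columns

-- The absolute values in columns x, y, -(x + y) with x = k+1, …, k+p+q, where for x = k+1, k+3, …
-- the y descend from a+p-1 to a, and for x = k+2, k+4, … they descend from b+q-1 to b.

run : Vec ℕ 5 → List ℕ
run (k ∷ a ∷ b ∷ p ∷ q ∷ []) =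
  interval (k + 1) (p + q) ++ interval a p ++ interval b q ++
  interval ((a + p) + k) p ++ interval (((b + q) + k) + 1) q ++ []

-- The last two spans contain the sums x + y. Within one kind of column x grows by 2 while y falls
-- by 1, so the sums grow by 1, from a + p + k and from b + q + k + 1 respectively.
runSpans : Vec (Form (suc d)) 5 → List (Span (suc d))
runSpans (k ∷ a ∷ b ∷ p ∷ q ∷ []) =
  (k ⊕ constant 1 , p ⊕ q) ∷ (a , p) ∷ (b , q) ∷
  ((a ⊕ p) ⊕ k , p) ∷ (((b ⊕ q) ⊕ k) ⊕ constant 1 , q) ∷ []

⟦runSpans⟧ : (ρ : Vec ℕ d) (fs : Vec (Form (suc d)) 5) →
             ⟦ runSpans fs ⟧* (1 ∷ ρ) ≡ run (map (λ f → ⟦ f ⟧ (1 ∷ ρ)) fs)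
⟦runSpans⟧ ρ (k ∷ a ∷ b ∷ p ∷ q ∷ []) =
  cong₂ _++_ (cong₂ interval (+1 k) (⊕₂ p q)) (cong (λ t → left ++ right ++ t) (cong₂ _++_
    (cong (λ s → interval s (⟦ p ⟧ (1 ∷ ρ))) (trans (⊕₂ (a ⊕ p) k) (cong (_+ _) (⊕₂ a p))))
    (cong (λ s → interval s (⟦ q ⟧ (1 ∷ ρ)) ++ []) (trans (+1 ((b ⊕ q) ⊕ k))
      (cong (_+ 1) (trans (⊕₂ (b ⊕ q) k) (cong (_+ _) (⊕₂ b q))))))))
  where
  left  = interval (⟦ a ⟧ (1 ∷ ρ)) (⟦ p ⟧ (1 ∷ ρ))
  right = interval (⟦ b ⟧ (1 ∷ ρ)) (⟦ q ⟧ (1 ∷ ρ))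
  ⊕₂ : ∀ f g → ⟦ f ⊕ g ⟧ (1 ∷ ρ) ≡ ⟦ f ⟧ (1 ∷ ρ) + ⟦ g ⟧ (1 ∷ ρ)
  ⊕₂ f g = ⟦⊕⟧ f g (1 ∷ ρ)
  +1 : ∀ f → ⟦ f ⊕ constant 1 ⟧ (1 ∷ ρ) ≡ ⟦ f ⟧ (1 ∷ ρ) + 1
  +1 f = trans (⊕₂ f (constant 1)) (cong (⟦ f ⟧ (1 ∷ ρ) +_) (⟦constant⟧ 1 ρ))

-- The letters list the rows from top to bottom, z standing for -(x + y); the sign given to `column`
-- multiplies the entire column.
data Order : Set where
  xyz xzy yxz yzx zxy zyx : Order

column : Order → Sign → Form d → Form d → Vec (Sign × Form d) 3
column xyz s x y = (s , x) ∷ (s , y) ∷ (Sign.opposite s , x ⊕ y) ∷ []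
column xzy s x y = (s , x) ∷ (Sign.opposite s , x ⊕ y) ∷ (s , y) ∷ []
column yxz s x y = (s , y) ∷ (s , x) ∷ (Sign.opposite s , x ⊕ y) ∷ []
column yzx s x y = (s , y) ∷ (Sign.opposite s , x ⊕ y) ∷ (s , x) ∷ []
column zxy s x y = (Sign.opposite s , x ⊕ y) ∷ (s , x) ∷ (s , y) ∷ []
column zyx s x y = (Sign.opposite s , x ⊕ y) ∷ (s , y) ∷ (s , x) ∷ []

-- The first w columns of a run, as linear forms in 1, k, a, b, p, q, where p and q count the columns of
-- either kind in the rest of the run.

private
  kᶠ aᶠ bᶠ pᶠ qᶠ : Form 6
  kᶠ = var 1F
  aᶠ = var 2F
  bᶠ = var 3F
  pᶠ = var 4F
  qᶠ = var 5F

  column₁ column₂ : Order → Sign → ℕ → ℕ → Vec (Sign × Form 6) 3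
  column₁ o s i j = column o s (kᶠ ⊕ constant i) ((aᶠ ⊕ pᶠ) ⊕ constant j)
  column₂ o s i j = column o s (kᶠ ⊕ constant i) ((bᶠ ⊕ qᶠ) ⊕ constant j)

-- The signs + - - + annihilate four consecutive x. In the row of the y, each kind contributes a
-- difference of neighbours, which is free of the centre, and the two differences are 1 and -1.
block₄ : FormArray 6 3 4
block₄ = formArray (transpose (
  column₁ xyz Sign.+ 1 1 ∷ column₂ xyz Sign.- 2 1 ∷
  column₁ xyz Sign.- 3 0 ∷ column₂ xyz Sign.+ 4 0 ∷ [])) refl refl

-- With order `xyz` throughout, the coefficient of k in the first row would be a sum of seven signs,
-- hence odd. This is why the order varies here, and likewise in `block₉`.
block₇ : FormArray 6 3 7
block₇ = formArray (transpose (
  column₁ xyz Sign.+ 1 3 ∷ column₂ xyz Sign.- 2 2 ∷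
  column₁ xyz Sign.- 3 2 ∷ column₂ yzx Sign.- 4 1 ∷
  column₁ yxz Sign.- 5 1 ∷ column₂ zxy Sign.- 6 0 ∷
  column₁ yxz Sign.+ 7 0 ∷ [])) refl refl

block₉ : FormArray 6 3 9
block₉ = formArray (transpose (
  column₁ xyz Sign.+ 1 4 ∷ column₂ xyz Sign.+ 2 3 ∷
  column₁ xyz Sign.- 3 3 ∷ column₂ xyz Sign.- 4 2 ∷
  column₁ xyz Sign.- 5 2 ∷ column₂ yxz Sign.+ 6 1 ∷
  column₁ zxy Sign.- 7 1 ∷ column₂ yxz Sign.- 8 0 ∷
  column₁ yzx Sign.- 9 0 ∷ [])) refl refl

-- Peeling a block off a run

Partition : ℕ → Set
Partition d = List (Form d × List (Form d))

parts wholes : Partition d → List (Span d)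
parts  = List.concatMap (uncurry tile)
wholes = List.map λ (s , ls) → s , List.foldr _⊕_ 0ᶠ ls

⟦parts⟧ : (ρ : Vec ℕ d) (π : Partition d) → ⟦ parts π ⟧* ρ ≡ ⟦ wholes π ⟧* ρ
⟦parts⟧ ρ []            = refl
⟦parts⟧ ρ ((s , ls) ∷ π) =
  trans (⟦++⟧ ρ (tile s ls) (parts π)) (cong₂ _++_ (⟦tile⟧ ρ s ls) (⟦parts⟧ ρ π))

-- Pieces are matched symbolically first; gluing each group of adjacent pieces then gives the
-- intended intervals.
⟦↭parts⟧ : {is js : List (Span d)} (ρ : Vec ℕ d) (π : Partition d) →
           is ↭ parts π → wholes π ≡ js → ⟦ is ⟧* ρ ↭ ⟦ js ⟧* ρ
⟦↭parts⟧ ρ π is↭ refl = ↭-trans (⟦↭⟧ ρ is↭) (↭-reflexive (⟦parts⟧ ρ π))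

⟦var+⟧ : ∀ (i : Fin (suc d)) k (ρ : Vec ℕ d) →
         ⟦ var i ⊕ constant k ⟧ (1 ∷ ρ) ≡ lookup (1 ∷ ρ) i + k
⟦var+⟧ i k ρ = trans (⟦⊕⟧ (var i) (constant k) (1 ∷ ρ)) (cong₂ _+_ (⟦var⟧ i (1 ∷ ρ)) (⟦constant⟧ k ρ))

singles : ℕ → List (Form (suc d))
singles n = List.replicate n (constant 1)

-- The five intervals of the longer run, with p + i and q + j columns. The peeled columns have the
-- smallest x, the largest y and the smallest sums of their kind; hence the side of each interval on
-- which the singles stand.
peeled : ℕ → ℕ → Partition 6
peeled i j =
  (kᶠ ⊕ constant 1 , singles (i + j) ++ (pᶠ ⊕ qᶠ) ∷ []) ∷
  (aᶠ , pᶠ ∷ singles i) ∷ (bᶠ , qᶠ ∷ singles j) ∷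
  ((aᶠ ⊕ (pᶠ ⊕ constant i)) ⊕ kᶠ , singles i ++ pᶠ ∷ []) ∷
  (((bᶠ ⊕ (qᶠ ⊕ constant j)) ⊕ kᶠ) ⊕ constant 1 , singles j ++ qᶠ ∷ []) ∷ []

-- If w is odd, the two kinds of columns change roles in the rest of the run.
aboveEven aboveOdd : ℕ → Vec (Form 6) 5
aboveEven w = (kᶠ ⊕ constant w) ∷ aᶠ ∷ bᶠ ∷ pᶠ ∷ qᶠ ∷ []
aboveOdd  w = (kᶠ ⊕ constant w) ∷ bᶠ ∷ aᶠ ∷ qᶠ ∷ pᶠ ∷ []

whole : ℕ → ℕ → Vec (Form 6) 5
whole i j = kᶠ ∷ aᶠ ∷ bᶠ ∷ (pᶠ ⊕ constant i) ∷ (qᶠ ⊕ constant j) ∷ []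

peels? : ∀ {w} (A : FormArray 6 3 w) (fs : Vec (Form 6) 5) (i j : ℕ) →
         Maybe (points A ++ runSpans fs ↭ parts (peeled i j))
peels? A fs i j = permutation? _≟ⁱ_ (points A ++ runSpans fs) (parts (peeled i j))

module _ (k₀ a₀ b₀ p₀ q₀ : ℕ) where
  private
    ρ : Vec ℕ 5
    ρ = k₀ ∷ a₀ ∷ b₀ ∷ p₀ ∷ q₀ ∷ []

    ⟦_⟧⁵ : Vec (Form 6) 5 → Vec ℕ 5
    ⟦_⟧⁵ = map (λ f → ⟦ f ⟧ (1 ∷ ρ))

    peel : ∀ {w u v} (A : FormArray 6 3 w) (fs : Vec (Form 6) 5) (i j : ℕ) →
           points A ++ runSpans fs ↭ parts (peeled i j) →
           wholes (peeled i j) ≡ runSpans (whole i j) →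
           ⟦ fs ⟧⁵ ≡ u → ⟦ whole i j ⟧⁵ ≡ v →
           labels (evaluate (1 ∷ ρ) A) ++ run u ↭ run v
    peel A fs i j is↭ eq refl refl = begin
      labels (evaluate (1 ∷ ρ) A) ++ run ⟦ fs ⟧⁵ ≡⟨ cong₂ _++_ (⟦points⟧ ρ A) (⟦runSpans⟧ ρ fs) ⟨
      ⟦ points A ⟧* (1 ∷ ρ) ++ ⟦ runSpans fs ⟧* (1 ∷ ρ) ≡⟨ ⟦++⟧ (1 ∷ ρ) (points A) (runSpans fs) ⟨
      ⟦ points A ++ runSpans fs ⟧* (1 ∷ ρ)       ↭⟨ ⟦↭parts⟧ (1 ∷ ρ) (peeled i j) is↭ eq ⟩
      ⟦ runSpans (whole i j) ⟧* (1 ∷ ρ)          ≡⟨ ⟦runSpans⟧ ρ (whole i j) ⟩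
      run ⟦ whole i j ⟧⁵                         ∎
      where open PermutationReasoning

    values : ∀ {i j k l m i′ j′ k′ l′ m′ : ℕ} → i ≡ i′ → j ≡ j′ → k ≡ k′ → l ≡ l′ → m ≡ m′ →
             _≡_ {A = Vec ℕ 5} (i ∷ j ∷ k ∷ l ∷ m ∷ []) (i′ ∷ j′ ∷ k′ ∷ l′ ∷ m′ ∷ [])
    values refl refl refl refl refl = refl

    ⟦v⟧ : (i : Fin 6) → ⟦ var i ⟧ (1 ∷ ρ) ≡ lookup (1 ∷ ρ) i
    ⟦v⟧ i = ⟦var⟧ i (1 ∷ ρ)

    ⟦aboveEven⟧ : ∀ w → ⟦ aboveEven w ⟧⁵ ≡ k₀ + w ∷ a₀ ∷ b₀ ∷ p₀ ∷ q₀ ∷ []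
    ⟦aboveEven⟧ w = values (⟦var+⟧ 1F w ρ) (⟦v⟧ 2F) (⟦v⟧ 3F) (⟦v⟧ 4F) (⟦v⟧ 5F)

    ⟦aboveOdd⟧ : ∀ w → ⟦ aboveOdd w ⟧⁵ ≡ k₀ + w ∷ b₀ ∷ a₀ ∷ q₀ ∷ p₀ ∷ []
    ⟦aboveOdd⟧ w = values (⟦var+⟧ 1F w ρ) (⟦v⟧ 3F) (⟦v⟧ 2F) (⟦v⟧ 5F) (⟦v⟧ 4F)

    ⟦whole⟧ : ∀ i j → ⟦ whole i j ⟧⁵ ≡ k₀ ∷ a₀ ∷ b₀ ∷ p₀ + i ∷ q₀ + j ∷ []
    ⟦whole⟧ i j = values (⟦v⟧ 1F) (⟦v⟧ 2F) (⟦v⟧ 3F) (⟦var+⟧ 4F i ρ) (⟦var+⟧ 5F j ρ)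

  peel₄ : Σ (Array 3 4) λ A → labels A ++ run (k₀ + 4 ∷ a₀ ∷ b₀ ∷ p₀ ∷ q₀ ∷ []) ↭
                              run (k₀ ∷ a₀ ∷ b₀ ∷ p₀ + 2 ∷ q₀ + 2 ∷ [])
  peel₄ = evaluate (1 ∷ ρ) block₄ , peel block₄ (aboveEven 4) 2 2
    (from-just (peels? block₄ (aboveEven 4) 2 2)) refl (⟦aboveEven⟧ 4) (⟦whole⟧ 2 2)

  peel₇ : Σ (Array 3 7) λ A → labels A ++ run (k₀ + 7 ∷ b₀ ∷ a₀ ∷ q₀ ∷ p₀ ∷ []) ↭
                              run (k₀ ∷ a₀ ∷ b₀ ∷ p₀ + 4 ∷ q₀ + 3 ∷ [])
  peel₇ = evaluate (1 ∷ ρ) block₇ , peel block₇ (aboveOdd 7) 4 3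
    (from-just (peels? block₇ (aboveOdd 7) 4 3)) refl (⟦aboveOdd⟧ 7) (⟦whole⟧ 4 3)

  peel₉ : Σ (Array 3 9) λ A → labels A ++ run (k₀ + 9 ∷ b₀ ∷ a₀ ∷ q₀ ∷ p₀ ∷ []) ↭
                              run (k₀ ∷ a₀ ∷ b₀ ∷ p₀ + 5 ∷ q₀ + 4 ∷ [])
  peel₉ = evaluate (1 ∷ ρ) block₉ , peel block₉ (aboveOdd 9) 5 4
    (from-just (peels? block₉ (aboveOdd 9) 5 4)) refl (⟦aboveOdd⟧ 9) (⟦whole⟧ 5 4)

-- Cutting runs into wide and narrow arrays

record Supply (w i j : ℕ) (L : List ℕ) : Set where
  constructor supply
  field
    wide   : Vec (Array 3 w) i
    narrow : Vec (Array 3 4) j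
    covers : allLabels wide ++ allLabels narrow ↭ L

_⊎ₛ_ : ∀ {i j i′ j′ L L′} → Supply w i j L → Supply w i′ j′ L′ → Supply w (i + i′) (j + j′) (L ++ L′)
supply As Bs e ⊎ₛ supply As′ Bs′ e′ = supply (As Vec.++ As′) (Bs Vec.++ Bs′) (begin
  allLabels (As Vec.++ As′) ++ allLabels (Bs Vec.++ Bs′) ≡⟨ cong₂ _++_ (allLabels-++ As As′) (allLabels-++ Bs Bs′) ⟩
  (a ++ a′) ++ b ++ b′ ≡⟨ List.++-assoc a a′ _ ⟩
  a ++ a′ ++ b ++ b′   ↭⟨ ↭.++⁺ˡ a (↭.shifts a′ b) ⟩
  a ++ b ++ a′ ++ b′   ≡⟨ List.++-assoc a b _ ⟨
  (a ++ b) ++ a′ ++ b′ ↭⟨ ↭.++⁺ e e′ ⟩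
  _ ∎)
  where
  open PermutationReasoning
  a = allLabels As ; a′ = allLabels As′ ; b = allLabels Bs ; b′ = allLabels Bs′

resupply : ∀ {i j L L′} → L ↭ L′ → Supply w i j L → Supply w i j L′
resupply L↭L′ (supply As Bs e) = supply As Bs (↭-trans e L↭L′)

oneWide : (A : Array 3 w) → Supply w 1 0 (labels A)
oneWide A = supply (A ∷ []) [] (↭-reflexive (trans (List.++-identityʳ _) (List.++-identityʳ _)))

oneNarrow : (A : Array 3 4) → Supply w 0 1 (labels A)
oneNarrow A = supply [] (A ∷ []) (↭-reflexive (List.++-identityʳ _))

-- Every block of four columns takes two of either kind, so j of them exhaust a run with p = q = 2
-- j.
narrowRun : ∀ j k a b → Supply w 0 j (run (k ∷ a ∷ b ∷ j * 2 ∷ j * 2 ∷ []))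
narrowRun zero    k a b = supply [] [] ↭-refl
narrowRun {w} (suc j) k a b =
  let A , e = peel₄ k a b (j * 2) (j * 2) in
  subst (λ m → Supply w 0 (suc j) (run (k ∷ a ∷ b ∷ m ∷ m ∷ []))) (ℕ.+-comm (j * 2) 2)
    (resupply e (oneNarrow A ⊎ₛ narrowRun j (k + 4) a b))

module WideRun (h w : ℕ)
  (peel : ∀ k a b p q → Σ (Array 3 w) λ A → labels A ++ run (k + w ∷ b ∷ a ∷ q ∷ p ∷ []) ↭
                                            run (k ∷ a ∷ b ∷ p + suc h ∷ q + h ∷ [])) where

  -- The numbers of columns of the first and of the second kind in a run of i wide blocks followed
  -- by j narrow ones. Each calls the other because a block of odd width exchanges the two kinds.
  front back : ℕ → ℕ → ℕ
  front zero    j = j * 2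
  front (suc i) j = back i j + suc h
  back  zero    j = j * 2
  back  (suc i) j = front i j + h

  wideRun : ∀ i j k a b → Supply w i j (run (k ∷ a ∷ b ∷ front i j ∷ back i j ∷ []))
  wideRun zero    j k a b = narrowRun j k a b
  wideRun (suc i) j k a b =
    let A , e = peel k a b (back i j) (front i j) in
    resupply e (oneWide A ⊎ₛ wideRun i j (k + w) b a)

  -- Two wide blocks in succession take `suc h + h` columns of each kind, so an even number of them
  -- leaves the kinds balanced.
  front≡back : ∀ t j → front (t * 2) j ≡ t * (suc h + h) + j * 2 × back (t * 2) j ≡ t * (suc h + h) + j * 2
  front≡back zero    j = refl , refl
  front≡back (suc t) j =
    let e , e′ = front≡back t j in
    trans (cong (λ x → x + h + suc h) e) (lemma h (t * (suc h + h)) (j * 2)) ,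
    trans (cong (λ x → x + suc h + h) e′) (lemma′ h (t * (suc h + h)) (j * 2))
    where
    lemma : ∀ h x y → ((x + y) + h) + suc h ≡ (suc h + h + x) + y
    lemma = solve-∀
    lemma′ : ∀ h x y → ((x + y) + suc h) + h ≡ (suc h + h + x) + y
    lemma′ = solve-∀

  -- In a tiling p and q are values of linear forms; the equations identify them with the counts
  -- that come from the numbers of blocks.
  evenRun : ∀ t j v → t * (suc h + h) + j * 2 ≡ lookup v 3F → t * (suc h + h) + j * 2 ≡ lookup v 4F →
            Supply w (t * 2) j (run v)
  evenRun t j (k ∷ a ∷ b ∷ _ ∷ _ ∷ []) refl refl = let e , e′ = front≡back t j in
    subst₂ (λ x y → Supply w (t * 2) j (run (k ∷ a ∷ b ∷ x ∷ y ∷ []))) e e′ (wideRun (t * 2) j k a b)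

  oddRun : ∀ t j v → t * (suc h + h) + j * 2 + suc h ≡ lookup v 3F → t * (suc h + h) + j * 2 + h ≡ lookup v 4F →
           Supply w (suc (t * 2)) j (run v)
  oddRun t j (k ∷ a ∷ b ∷ _ ∷ _ ∷ []) refl refl = let e , e′ = front≡back t j in
    subst₂ (λ x y → Supply w (suc (t * 2)) j (run (k ∷ a ∷ b ∷ x ∷ y ∷ [])))
      (cong (_+ suc h) e′) (cong (_+ h) e) (wideRun (suc (t * 2)) j k a b)

open WideRun 3 7 peel₇ using () renaming (evenRun to evenRun₇; oddRun to oddRun₇)
open WideRun 4 9 peel₉ using () renaming (evenRun to evenRun₉; oddRun to oddRun₉)

-- Tilings of an initial interval by two runs and extra arrays

-- i n + j
ℓ : ℕ → ℕ → Form 2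
ℓ i j = j ∷ i ∷ []

at : ℕ → Vec (Form 2) 5 → Vec ℕ 5
at n = map (λ f → ⟦ f ⟧ (1 ∷ n ∷ []))

-- The parameters k, a, b, p, q of the run with the smaller and of the run with the larger x, and the
-- lengths of the intervals into which the initial interval is cut.
record Tiling : Set where
  constructor tiling
  field
    lower upper : Vec (Form 2) 5
    pieces      : List (Form 2)

open Tiling

record Tiles (is : List (Span 2)) (T : Tiling) : Set where
  constructor tiles
  field permuted : is ++ runSpans (lower T) ++ runSpans (upper T) ↭ tile (constant 1) (pieces T)

tiles? : ∀ is T → Maybe (Tiles is T)
tiles? is T = Maybe.map tiles (permutation? _≟ⁱ_ _ _)

-- N is forced by the number of cells, 3 w i + 12 j, and is therefore left existential.
Packing : ℕ → ℕ → ℕ → Set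
Packing w i j = ∃ λ N → Supply w i j (interval 1 N)

module _ {is T} (is-tiles : Tiles is T) (n : ℕ) where
  private
    ρ : Vec ℕ 2
    ρ = 1 ∷ n ∷ []

    tiled : ∃ λ N → ⟦ is ⟧* ρ ++ run (at n (lower T)) ++ run (at n (upper T)) ↭ interval 1 N
    tiled = _ , (begin
      ⟦ is ⟧* ρ ++ run (at n (lower T)) ++ run (at n (upper T))
        ≡⟨ cong (⟦ is ⟧* ρ ++_) (cong₂ _++_ (⟦runSpans⟧ _ (lower T)) (⟦runSpans⟧ _ (upper T))) ⟨
      ⟦ is ⟧* ρ ++ ⟦ runSpans (lower T) ⟧* ρ ++ ⟦ runSpans (upper T) ⟧* ρ
        ≡⟨ cong (⟦ is ⟧* ρ ++_) (⟦++⟧ ρ (runSpans (lower T)) _) ⟨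
      ⟦ is ⟧* ρ ++ ⟦ runSpans (lower T) ++ runSpans (upper T) ⟧* ρ
        ≡⟨ ⟦++⟧ ρ is _ ⟨
      ⟦ is ++ runSpans (lower T) ++ runSpans (upper T) ⟧* ρ
        ↭⟨ ⟦↭⟧ ρ (Tiles.permuted is-tiles) ⟩
      ⟦ tile (constant 1) (pieces T) ⟧* ρ
        ≡⟨ ⟦tile⟧ ρ (constant 1) (pieces T) ⟩
      interval 1 _ ∎)
      where open PermutationReasoning

  pack : ∀ {i j i₁ j₁ i₂ j₂} → Supply w i j (⟦ is ⟧* ρ) → Supply w i₁ j₁ (run (at n (lower T))) →
         Supply w i₂ j₂ (run (at n (upper T))) → Packing w (i + (i₁ + i₂)) (j + (j₁ + j₂))
  pack S S₁ S₂ = _ , resupply (proj₂ tiled) (S ⊎ₛ (S₁ ⊎ₛ S₂))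

extraWide : (A : FormArray 2 3 w) (n : ℕ) → Supply w 1 0 (⟦ points A ⟧* (1 ∷ n ∷ []))
extraWide A n = subst (Supply _ 1 0) (sym (⟦points⟧ (n ∷ []) A)) (oneWide (evaluate (1 ∷ n ∷ []) A))

extraNarrow : (A B : FormArray 2 3 4) (n : ℕ) → Supply w 0 2 (⟦ points A ++ points B ⟧* (1 ∷ n ∷ []))
extraNarrow A B n = subst (Supply _ 0 2)
  (sym (trans (⟦++⟧ (1 ∷ n ∷ []) (points A) (points B)) (cong₂ _++_ (⟦points⟧ (n ∷ []) A) (⟦points⟧ (n ∷ []) B))))
  (oneNarrow (evaluate (1 ∷ n ∷ []) A) ⊎ₛ oneNarrow (evaluate (1 ∷ n ∷ []) B))

-- Found by computer search.  The lower run is longer than the upper one by 0 columns in tiling₇, tiling₉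
-- and tiling₈, by 4 in tiling₇′, tiling₉′ and tiling₈′, by 7 in tiling₇″ and by 9 in tiling₉″.

extra₇ : FormArray 2 3 7
extra₇ = formArray (transpose (
  column xyz Sign.+ (ℓ 0 1) (ℓ 5 11) ∷ column yxz Sign.+ (ℓ 2 5) (ℓ 9 19) ∷
  column zyx Sign.- (ℓ 2 3) (ℓ 9 20) ∷ column yxz Sign.- (ℓ 4 9) (ℓ 8 18) ∷
  column zyx Sign.+ (ℓ 4 7) (ℓ 6 14) ∷ column xzy Sign.+ (ℓ 2 4) (ℓ 10 22) ∷
  column xzy Sign.- (ℓ 4 8) (ℓ 8 17) ∷ [])) refl refl

tiling₇ : Tiling
tiling₇ = tiling
  (ℓ 0 1 ∷ ℓ 5 13 ∷ ℓ 9 21 ∷ ℓ 1 1 ∷ ℓ 1 0 ∷ [])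
  (ℓ 2 5 ∷ ℓ 4 10 ∷ ℓ 8 19 ∷ ℓ 1 1 ∷ ℓ 1 0 ∷ []) (
    singles 1 ++ ℓ 2 1 ∷ singles 3 ++ ℓ 2 1 ∷ singles 3 ++ ℓ 1 1 ∷ singles 2 ++ ℓ 1 1 ∷
    singles 1 ++ ℓ 1 1 ∷ ℓ 1 1 ∷ singles 2 ++ ℓ 1 0 ∷ singles 2 ++ ℓ 1 0 ∷ singles 2 ++
    ℓ 1 0 ∷ singles 2 ++ ℓ 1 0 ∷ singles 3 ++ [])

tiles₇ : Tiles (points extra₇) tiling₇
tiles₇ = from-just (tiles? (points extra₇) tiling₇)

extra₇′ : FormArray 2 3 7
extra₇′ = formArray (transpose (
  column xyz Sign.+ (ℓ 2 9) (ℓ 9 27) ∷ column yxz Sign.+ (ℓ 2 7) (ℓ 9 28) ∷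
  column xyz Sign.- (ℓ 2 8) (ℓ 10 31) ∷ column yzx Sign.- (ℓ 0 1) (ℓ 5 15) ∷
  column xzy Sign.+ (ℓ 4 11) (ℓ 8 26) ∷ column xyz Sign.- (ℓ 4 12) (ℓ 6 20) ∷
  column xzy Sign.- (ℓ 4 13) (ℓ 8 25) ∷ [])) refl refl

tiling₇′ : Tiling
tiling₇′ = tiling
  (ℓ 0 1 ∷ ℓ 5 17 ∷ ℓ 9 29 ∷ ℓ 1 3 ∷ ℓ 1 2 ∷ [])
  (ℓ 2 9 ∷ ℓ 4 14 ∷ ℓ 8 27 ∷ ℓ 1 1 ∷ ℓ 1 0 ∷ []) (
    singles 1 ++ ℓ 2 5 ∷ singles 3 ++ ℓ 2 1 ∷ singles 3 ++ ℓ 1 1 ∷ singles 2 ++ ℓ 1 3 ∷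
    singles 1 ++ ℓ 1 3 ∷ ℓ 1 1 ∷ singles 2 ++ ℓ 1 0 ∷ singles 2 ++ ℓ 1 2 ∷ singles 2 ++
    ℓ 1 2 ∷ singles 2 ++ ℓ 1 0 ∷ singles 3 ++ [])

tiles₇′ : Tiles (points extra₇′) tiling₇′
tiles₇′ = from-just (tiles? (points extra₇′) tiling₇′)

extra₇″ : FormArray 2 3 7
extra₇″ = formArray (transpose (
  column xyz Sign.+ (ℓ 0 2) (ℓ 4 17) ∷ column xzy Sign.+ (ℓ 2 11) (ℓ 4 18) ∷
  column xzy Sign.- (ℓ 2 13) (ℓ 9 35) ∷ column xyz Sign.- (ℓ 2 12) (ℓ 4 16) ∷
  column yzx Sign.+ (ℓ 4 15) (ℓ 6 27) ∷ column zxy Sign.+ (ℓ 0 1) (ℓ 9 36) ∷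
  column yxz Sign.+ (ℓ 5 21) (ℓ 5 22) ∷ [])) refl refl

tiling₇″ : Tiling
tiling₇″ = tiling
  (ℓ 0 2 ∷ ℓ 9 38 ∷ ℓ 5 23 ∷ ℓ 1 4 ∷ ℓ 1 4 ∷ [])
  (ℓ 2 13 ∷ ℓ 4 20 ∷ ℓ 8 35 ∷ ℓ 1 1 ∷ ℓ 1 0 ∷ []) (
    singles 2 ++ ℓ 2 8 ∷ singles 3 ++ ℓ 2 1 ∷ singles 5 ++ ℓ 1 1 ∷ singles 2 ++ ℓ 1 4 ∷
    singles 3 ++ ℓ 1 4 ∷ ℓ 1 1 ∷ ℓ 1 0 ∷ singles 3 ++ ℓ 1 4 ∷ singles 2 ++ ℓ 1 4 ∷
    singles 1 ++ ℓ 1 0 ∷ [])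

tiles₇″ : Tiles (points extra₇″) tiling₇″
tiles₇″ = from-just (tiles? (points extra₇″) tiling₇″)

extra₉ : FormArray 2 3 9
extra₉ = formArray (transpose (
  column xyz Sign.+ (ℓ 0 4) (ℓ 6 12) ∷ column xyz Sign.+ (ℓ 0 3) (ℓ 10 20) ∷
  column xyz Sign.- (ℓ 0 2) (ℓ 11 24) ∷ column xyz Sign.- (ℓ 2 7) (ℓ 4 8) ∷
  column xyz Sign.- (ℓ 2 5) (ℓ 8 17) ∷ column xyz Sign.+ (ℓ 4 9) (ℓ 8 18) ∷
  column zyx Sign.+ (ℓ 2 6) (ℓ 9 19) ∷ column yxz Sign.+ (ℓ 0 1) (ℓ 6 13) ∷
  column xzy Sign.+ (ℓ 5 10) (ℓ 5 11) ∷ [])) refl refl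

tiling₉ : Tiling
tiling₉ = tiling
  (ℓ 0 4 ∷ ℓ 9 20 ∷ ℓ 5 12 ∷ ℓ 1 0 ∷ ℓ 1 0 ∷ [])
  (ℓ 2 7 ∷ ℓ 4 10 ∷ ℓ 8 19 ∷ ℓ 1 0 ∷ ℓ 1 0 ∷ []) (
    singles 4 ++ ℓ 2 0 ∷ singles 3 ++ ℓ 2 0 ∷ singles 2 ++ ℓ 1 0 ∷ singles 2 ++ ℓ 1 0 ∷
    singles 5 ++ ℓ 1 0 ∷ ℓ 1 0 ∷ singles 2 ++ ℓ 1 0 ∷ singles 1 ++ ℓ 1 0 ∷ singles 4 ++
    ℓ 1 0 ∷ singles 3 ++ ℓ 1 0 ∷ singles 1 ++ [])

tiles₉ : Tiles (points extra₉) tiling₉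
tiles₉ = from-just (tiles? (points extra₉) tiling₉)

extra₉′ : FormArray 2 3 9
extra₉′ = formArray (transpose (
  column xyz Sign.+ (ℓ 4 13) (ℓ 8 25) ∷ column xyz Sign.+ (ℓ 2 11) (ℓ 9 26) ∷
  column xyz Sign.- (ℓ 2 10) (ℓ 5 14) ∷ column yxz Sign.- (ℓ 2 9) (ℓ 10 30) ∷
  column zxy Sign.+ (ℓ 0 2) (ℓ 6 19) ∷ column zyx Sign.- (ℓ 5 15) (ℓ 5 16) ∷
  column xyz Sign.+ (ℓ 2 8) (ℓ 4 12) ∷ column zyx Sign.- (ℓ 2 7) (ℓ 9 27) ∷
  column zxy Sign.+ (ℓ 0 1) (ℓ 11 35) ∷ [])) refl refl

tiling₉′ : Tiling
tiling₉′ = tiling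
  (ℓ 0 2 ∷ ℓ 9 28 ∷ ℓ 5 17 ∷ ℓ 1 2 ∷ ℓ 1 2 ∷ [])
  (ℓ 2 11 ∷ ℓ 4 14 ∷ ℓ 8 26 ∷ ℓ 1 0 ∷ ℓ 1 0 ∷ []) (
    singles 2 ++ ℓ 2 4 ∷ singles 5 ++ ℓ 2 0 ∷ singles 2 ++ ℓ 1 0 ∷ singles 3 ++ ℓ 1 2 ∷
    singles 3 ++ ℓ 1 2 ∷ singles 1 ++ ℓ 1 0 ∷ singles 1 ++ ℓ 1 0 ∷ singles 2 ++ ℓ 1 2 ∷
    singles 2 ++ ℓ 1 2 ∷ singles 4 ++ ℓ 1 0 ∷ singles 2 ++ [])

tiles₉′ : Tiles (points extra₉′) tiling₉′
tiles₉′ = from-just (tiles? (points extra₉′) tiling₉′)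

extra₉″ : FormArray 2 3 9
extra₉″ = formArray (transpose (
  column xyz Sign.+ (ℓ 2 15) (ℓ 9 39) ∷ column yxz Sign.+ (ℓ 2 16) (ℓ 5 21) ∷
  column yzx Sign.- (ℓ 0 1) (ℓ 7 35) ∷ column yxz Sign.- (ℓ 2 14) (ℓ 10 45) ∷
  column xyz Sign.- (ℓ 0 3) (ℓ 12 57) ∷ column zyx Sign.- (ℓ 0 2) (ℓ 12 56) ∷
  column yxz Sign.+ (ℓ 4 18) (ℓ 6 28) ∷ column xyz Sign.- (ℓ 4 19) (ℓ 6 29) ∷
  column xzy Sign.- (ℓ 4 20) (ℓ 6 27) ∷ [])) refl refl

tiling₉″ : Tiling
tiling₉″ = tiling
  (ℓ 0 3 ∷ ℓ 5 22 ∷ ℓ 9 40 ∷ ℓ 1 5 ∷ ℓ 1 5 ∷ [])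
  (ℓ 2 16 ∷ ℓ 8 38 ∷ ℓ 4 21 ∷ ℓ 1 1 ∷ ℓ 1 0 ∷ []) (
    singles 3 ++ ℓ 2 10 ∷ singles 3 ++ ℓ 2 1 ∷ singles 3 ++ ℓ 1 0 ∷ singles 1 ++ ℓ 1 5 ∷
    singles 3 ++ ℓ 1 5 ∷ singles 3 ++ ℓ 1 0 ∷ ℓ 1 1 ∷ singles 1 ++ ℓ 1 5 ∷ singles 4 ++
    ℓ 1 5 ∷ singles 1 ++ ℓ 1 1 ∷ singles 5 ++ [])

tiles₉″ : Tiles (points extra₉″) tiling₉″
tiles₉″ = from-just (tiles? (points extra₉″) tiling₉″)

extra₈a : FormArray 2 3 4
extra₈a = formArray (transpose (
  column xyz Sign.+ (ℓ 2 5) (ℓ 10 19) ∷ column xyz Sign.- (ℓ 4 8) (ℓ 7 13) ∷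
  column xyz Sign.- (ℓ 0 1) (ℓ 12 22) ∷ column xyz Sign.+ (ℓ 2 4) (ℓ 9 16) ∷ [])) refl refl

extra₈b : FormArray 2 3 4
extra₈b = formArray (transpose (
  column xyz Sign.+ (ℓ 4 7) (ℓ 6 11) ∷ column xzy Sign.- (ℓ 4 6) (ℓ 4 9) ∷
  column xzy Sign.+ (ℓ 2 2) (ℓ 5 10) ∷ column xyz Sign.- (ℓ 2 3) (ℓ 7 14) ∷ [])) refl refl

tiling₈ : Tiling
tiling₈ = tiling
  (ℓ 0 1 ∷ ℓ 5 11 ∷ ℓ 9 18 ∷ ℓ 1 0 ∷ ℓ 1 0 ∷ [])
  (ℓ 2 5 ∷ ℓ 4 10 ∷ ℓ 8 16 ∷ ℓ 1 0 ∷ ℓ 1 0 ∷ []) (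
    singles 1 ++ ℓ 2 0 ∷ singles 4 ++ ℓ 2 0 ∷ singles 4 ++ ℓ 1 0 ∷ singles 1 ++ ℓ 1 0 ∷
    singles 1 ++ ℓ 1 0 ∷ singles 3 ++ ℓ 1 0 ∷ singles 1 ++ ℓ 1 0 ∷ singles 2 ++ ℓ 1 0 ∷
    singles 2 ++ ℓ 1 0 ∷ singles 2 ++ ℓ 1 0 ∷ singles 3 ++ [])

tiles₈ : Tiles (points extra₈a ++ points extra₈b) tiling₈
tiles₈ = from-just (tiles? (points extra₈a ++ points extra₈b) tiling₈)

extra₈′a : FormArray 2 3 4
extra₈′a = formArray (transpose (
  column xyz Sign.+ (ℓ 4 9) (ℓ 4 14) ∷ column xzy Sign.- (ℓ 4 10) (ℓ 8 26) ∷
  column xzy Sign.+ (ℓ 2 7) (ℓ 8 25) ∷ column xyz Sign.- (ℓ 2 6) (ℓ 6 18) ∷ [])) refl refl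

extra₈′b : FormArray 2 3 4
extra₈′b = formArray (transpose (
  column xyz Sign.+ (ℓ 4 12) (ℓ 5 15) ∷ column zxy Sign.+ (ℓ 2 8) (ℓ 4 11) ∷
  column yxz Sign.- (ℓ 0 1) (ℓ 9 28) ∷ column zyx Sign.- (ℓ 4 13) (ℓ 7 22) ∷ [])) refl refl

tiling₈′ : Tiling
tiling₈′ = tiling
  (ℓ 0 1 ∷ ℓ 9 30 ∷ ℓ 5 16 ∷ ℓ 1 2 ∷ ℓ 1 2 ∷ [])
  (ℓ 2 8 ∷ ℓ 4 15 ∷ ℓ 8 27 ∷ ℓ 1 0 ∷ ℓ 1 0 ∷ []) (
    singles 1 ++ ℓ 2 4 ∷ singles 3 ++ ℓ 2 0 ∷ singles 6 ++ ℓ 1 0 ∷ singles 1 ++ ℓ 1 2 ∷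
    singles 2 ++ ℓ 1 2 ∷ singles 1 ++ ℓ 1 0 ∷ singles 4 ++ ℓ 1 0 ∷ singles 3 ++ ℓ 1 2 ∷
    singles 1 ++ ℓ 1 2 ∷ singles 1 ++ ℓ 1 0 ∷ singles 1 ++ [])

tiles₈′ : Tiles (points extra₈′a ++ points extra₈′b) tiling₈′
tiles₈′ = from-just (tiles? (points extra₈′a ++ points extra₈′b) tiling₈′)

-- Packings obtained from the tilings

private
  -- The right-hand sides here and below are the values of `ℓ 1 1` and `ℓ 1 0` as evaluation leaves
  -- them, with n the number of columns of the second kind.
  front₇ : ∀ x y → x + y + 4 ≡ 1 + (1 * (x + y + 3) + 0)
  front₇ = solve-∀

  back₇ : ∀ x y → x + y + 3 ≡ 0 + (1 * (x + y + 3) + 0)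
  back₇ = solve-∀

  front₉ : ∀ x y → x + y + 5 ≡ 1 + (1 * (x + y + 4) + 0)
  front₉ = solve-∀

  back₉ : ∀ x y → x + y + 4 ≡ 0 + (1 * (x + y + 4) + 0)
  back₉ = solve-∀

-- The extra array and two runs with 2 t + 1 wide blocks each make 4 t + 3 wide arrays.
pack₇ : ∀ t j → Packing 7 (1 + (suc (t * 2) + suc (t * 2))) (j + j)
pack₇ t j = pack tiles₇ ν (extraWide extra₇ ν)
  (oddRun₇ t j (at ν (lower tiling₇)) (front₇ (t * 7) (j * 2)) (back₇ (t * 7) (j * 2)))
  (oddRun₇ t j (at ν (upper tiling₇)) (front₇ (t * 7) (j * 2)) (back₇ (t * 7) (j * 2)))
  where
  ν = t * 7 + j * 2 + 3

-- An odd number of narrow arrays: the odd one lengthens the lower run by 4 columns.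
pack₇′ : ∀ t j → Packing 7 (1 + (suc (t * 2) + suc (t * 2))) (suc j + j)
pack₇′ t j = pack tiles₇′ ν (extraWide extra₇′ ν)
  (oddRun₇ t (suc j) (at ν (lower tiling₇′)) (p≡ (t * 7) (j * 2)) (q≡ (t * 7) (j * 2)))
  (oddRun₇ t j (at ν (upper tiling₇′)) (front₇ (t * 7) (j * 2)) (back₇ (t * 7) (j * 2)))
  where
  ν = t * 7 + j * 2 + 3
  p≡ : ∀ x y → x + (2 + y) + 4 ≡ 3 + (1 * (x + y + 3) + 0)
  p≡ = solve-∀
  q≡ : ∀ x y → x + (2 + y) + 3 ≡ 2 + (1 * (x + y + 3) + 0)
  q≡ = solve-∀

-- One more wide block in the lower run raises the number of wide arrays to 4 t + 4. The kinds are
-- balanced in the lower run, and differ by one column in the upper run.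
pack₇″ : ∀ t j → Packing 7 (1 + (suc t * 2 + suc (t * 2))) (j + j)
pack₇″ t j = pack tiles₇″ ν (extraWide extra₇″ ν)
  (evenRun₇ (suc t) j (at ν (lower tiling₇″)) (p≡ (t * 7) (j * 2)) (p≡ (t * 7) (j * 2)))
  (oddRun₇ t j (at ν (upper tiling₇″)) (front₇ (t * 7) (j * 2)) (back₇ (t * 7) (j * 2)))
  where
  ν = t * 7 + j * 2 + 3
  p≡ : ∀ x y → 7 + x + y ≡ 4 + (1 * (x + y + 3) + 0)
  p≡ = solve-∀

pack₉ : ∀ t j → Packing 9 (1 + (t * 2 + t * 2)) (j + j)
pack₉ t j = pack tiles₉ ν (extraWide extra₉ ν)
  (evenRun₉ t j (at ν (lower tiling₉)) (p≡ (t * 9) (j * 2)) (p≡ (t * 9) (j * 2)))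
  (evenRun₉ t j (at ν (upper tiling₉)) (p≡ (t * 9) (j * 2)) (p≡ (t * 9) (j * 2)))
  where
  ν = t * 9 + j * 2
  p≡ : ∀ x y → x + y ≡ 0 + (1 * (x + y) + 0)
  p≡ = solve-∀

pack₉′ : ∀ t j → Packing 9 (1 + (t * 2 + t * 2)) (suc j + j)
pack₉′ t j = pack tiles₉′ ν (extraWide extra₉′ ν)
  (evenRun₉ t (suc j) (at ν (lower tiling₉′)) (p≡ (t * 9) (j * 2)) (p≡ (t * 9) (j * 2)))
  (evenRun₉ t j (at ν (upper tiling₉′)) (p≡′ (t * 9) (j * 2)) (p≡′ (t * 9) (j * 2)))
  where
  ν = t * 9 + j * 2
  p≡ : ∀ x y → x + (2 + y) ≡ 2 + (1 * (x + y) + 0)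
  p≡ = solve-∀
  p≡′ : ∀ x y → x + y ≡ 0 + (1 * (x + y) + 0)
  p≡′ = solve-∀

pack₉″ : ∀ t j → Packing 9 (1 + (suc t * 2 + suc (t * 2))) (j + j)
pack₉″ t j = pack tiles₉″ ν (extraWide extra₉″ ν)
  (evenRun₉ (suc t) j (at ν (lower tiling₉″)) (p≡ (t * 9) (j * 2)) (p≡ (t * 9) (j * 2)))
  (oddRun₉ t j (at ν (upper tiling₉″)) (front₉ (t * 9) (j * 2)) (back₉ (t * 9) (j * 2)))
  where
  ν = t * 9 + j * 2 + 4
  p≡ : ∀ x y → 9 + x + y ≡ 5 + (1 * (x + y + 4) + 0)
  p≡ = solve-∀

fourRun : ∀ j v → j * 2 ≡ lookup v 3F → j * 2 ≡ lookup v 4F → Supply w 0 j (run v)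
fourRun j (k ∷ a ∷ b ∷ _ ∷ _ ∷ []) refl refl = narrowRun j k a b

pack₈ : ∀ j → Packing w 0 (2 + (j + j))
pack₈ j = pack tiles₈ (j * 2) (extraNarrow extra₈a extra₈b (j * 2))
  (fourRun j (at (j * 2) (lower tiling₈)) (p≡ (j * 2)) (p≡ (j * 2)))
  (fourRun j (at (j * 2) (upper tiling₈)) (p≡ (j * 2)) (p≡ (j * 2)))
  where
  p≡ : ∀ x → x ≡ 0 + (1 * x + 0)
  p≡ = solve-∀

pack₈′ : ∀ j → Packing w 0 (2 + (suc j + j))
pack₈′ j = pack tiles₈′ (j * 2) (extraNarrow extra₈′a extra₈′b (j * 2))
  (fourRun (suc j) (at (j * 2) (lower tiling₈′)) (p≡ (j * 2)) (p≡ (j * 2)))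
  (fourRun j (at (j * 2) (upper tiling₈′)) (p≡′ (j * 2)) (p≡′ (j * 2)))
  where
  p≡ : ∀ x → 2 + x ≡ 2 + (1 * x + 0)
  p≡ = solve-∀
  p≡′ : ∀ x → x ≡ 0 + (1 * x + 0)
  p≡′ = solve-∀

-- The tilings without wide arrays contain two extra narrow ones, so a single narrow array needs an
-- example of its own.
H₃₄ : Array 3 4
H₃₄ = mkArray
  ( (ℤ.+ 1    ∷ ℤ.+ 2     ∷ ℤ.+ 3    ∷ -[1+ 5 ] ∷ [])
  ∷ (ℤ.+ 8    ∷ -[1+ 11 ] ∷ -[1+ 6 ] ∷ ℤ.+ 11   ∷ [])
  ∷ (-[1+ 8 ] ∷ ℤ.+ 10    ∷ ℤ.+ 4    ∷ -[1+ 4 ] ∷ []) ∷ []) refl refl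

pack₄ : Packing w 0 1
pack₄ = 12 , resupply (from-just (permutation? ℕ._≟_ (labels H₃₄) (interval 1 12))) (oneNarrow H₃₄)

halve : ∀ n → (∃ λ m → m + m ≡ n) ⊎ (∃ λ m → suc m + m ≡ n)
halve zero = inj₁ (0 , refl)
halve (suc n) with halve n
... | inj₁ (m , refl) = inj₂ (m , refl)
... | inj₂ (m , refl) = inj₁ (suc m , cong suc (ℕ.+-suc m m))

packing₄ : ∀ j → 0 < j → Packing w 0 j
packing₄ (suc zero)    _ = pack₄
packing₄ (suc (suc j)) _ with halve j
... | inj₁ (m , refl) = pack₈ m
... | inj₂ (m , refl) = pack₈′ m

4∣ : ∀ r i → i % 4 ≡ r → r + i / 4 * 4 ≡ i
4∣ r i eq = trans (cong (_+ i / 4 * 4) (sym eq)) (sym (m≡m%n+[m/n]*n i 4))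

-- A signed sum of 1, ..., N can vanish only if N is 0 or 3 mod 4, and N = 21 i + 12 j is congruent
-- to i. For remainder 3 the runs have equally many wide blocks, and for positive i with remainder 0
-- the lower one has one more; in the latter case both runs have equally many narrow blocks, whence
-- the parity of j.
packing₇ : ∀ i j → i % 4 ≡ 3 ⊎ (i % 4 ≡ 0 × 2 ∣ j) → 0 < i + j → Packing 7 i j
packing₇ i j (inj₁ eq) _ = subst (λ i → Packing 7 i j) (trans (lemma (i / 4)) (4∣ 3 i eq)) (go (halve j))
  where
  lemma : ∀ t → 1 + ((1 + t * 2) + (1 + t * 2)) ≡ 3 + t * 4
  lemma = solve-∀
  go : _ → Packing 7 (1 + (suc (i / 4 * 2) + suc (i / 4 * 2))) j
  go (inj₁ (m , refl)) = pack₇ (i / 4) m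
  go (inj₂ (m , refl)) = pack₇′ (i / 4) m
packing₇ zero j (inj₂ _) 0<j = packing₄ j 0<j
packing₇ i@(suc _) _ (inj₂ (eq , divides m refl)) _ with i / 4 | 4∣ 0 i eq
-- As i is positive, so is i / 4, and 4 (t + 1) splits as 1 + (2 t + 2) + (2 t + 1).
... | suc t | eq′ = subst₂ (Packing 7) (trans (lemma t) eq′) (lemma′ m) (pack₇″ t m)
  where
  lemma : ∀ t → 1 + (((2 + t * 2)) + (1 + t * 2)) ≡ 4 + t * 4
  lemma = solve-∀
  lemma′ : ∀ m → m + m ≡ m * 2
  lemma′ = solve-∀

-- Here N = 27 i + 12 j is congruent to 3 i, so the remainders 0 and 3 of N become 0 and 1 for i.
packing₉ : ∀ i j → i % 4 ≡ 1 ⊎ (i % 4 ≡ 0 × 2 ∣ j) → 0 < i + j → Packing 9 i j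
packing₉ i j (inj₁ eq) _ = subst (λ i → Packing 9 i j) (trans (lemma (i / 4)) (4∣ 1 i eq)) (go (halve j))
  where
  lemma : ∀ t → 1 + (t * 2 + t * 2) ≡ 1 + t * 4
  lemma = solve-∀
  go : _ → Packing 9 (1 + (i / 4 * 2 + i / 4 * 2)) j
  go (inj₁ (m , refl)) = pack₉ (i / 4) m
  go (inj₂ (m , refl)) = pack₉′ (i / 4) m
packing₉ zero j (inj₂ _) 0<j = packing₄ j 0<j
packing₉ i@(suc _) _ (inj₂ (eq , divides m refl)) _ with i / 4 | 4∣ 0 i eq
... | suc t | eq′ = subst₂ (Packing 9) (trans (lemma t) eq′) (lemma′ m) (pack₉″ t m)
  where
  lemma : ∀ t → 1 + (((2 + t * 2)) + (1 + t * 2)) ≡ 4 + t * 4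
  lemma = solve-∀
  lemma′ : ∀ m → m + m ≡ m * 2
  lemma′ = solve-∀

-- Reading off the cells

interval-≥ : ∀ s l → All (s ≤_) (interval s l)
interval-≥ s zero    = []
interval-≥ s (suc l) = ℕ.≤-refl ∷ All.map (ℕ.≤-trans (ℕ.n≤1+n s)) (interval-≥ (suc s) l)

interval-< : ∀ s l → All (_< s + l) (interval s l)
interval-< s zero    = []
interval-< s (suc l) = ℕ.m<m+n s (s≤s z≤n) ∷
  subst (λ t → All (_< t) (interval (suc s) l)) (sym (ℕ.+-suc s l)) (interval-< (suc s) l)

interval-unique : ∀ s l → Unique (interval s l)
interval-unique s zero    = []
interval-unique s (suc l) = All.map ℕ.<⇒≢ (interval-≥ (suc s) l) ∷ interval-unique (suc s) l

length-interval : ∀ s l → length (interval s l) ≡ l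
length-interval s zero    = refl
length-interval s (suc l) = cong suc (length-interval (suc s) l)

unique-++ : (xs : List A) {ys : List A} → Unique (xs ++ ys) →
            Unique xs × Unique ys × (∀ {x} → x ∈ xs → x ∈ ys → ∀ {P : Set} → P)
unique-++ []       u       = [] , u , λ ()
unique-++ (x ∷ xs) (p ∷ u) =
  let u₁ , u₂ , disjoint = unique-++ xs u ; p₁ , p₂ = All.++⁻ xs p in
  p₁ ∷ u₁ , u₂ , λ { (here refl) y∈ → contradiction refl (All.lookup p₂ y∈)
                   ; (there x∈) y∈ → disjoint x∈ y∈ }

unique-concat : (xss : Vec (List A) n) → Unique (List.concat (toList xss)) →
                (∀ i → Unique (lookup xss i)) ×
                (∀ {i j x} → x ∈ lookup xss i → x ∈ lookup xss j → i ≡ j)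
∈-concat : ∀ {x} (xss : Vec (List A) n) i → x ∈ lookup xss i → x ∈ List.concat (toList xss)

∈-concat (xs ∷ xss) zero    x∈ = ∈-++⁺ˡ x∈
∈-concat (xs ∷ xss) (suc i) x∈ = ∈-++⁺ʳ xs (∈-concat xss i x∈)

unique-concat []         u = (λ ()) , λ { {()} }
unique-concat (xs ∷ xss) u with u₁ , u₂ , disjoint ← unique-++ xs u with us , inj ← unique-concat xss u₂ =
  (λ { zero → u₁ ; (suc i) → us i }) , λ
  { {zero}  {zero}  _  _  → refl
  ; {zero}  {suc j} x∈ y∈ → disjoint x∈ (∈-concat xss j y∈)
  ; {suc i} {zero}  x∈ y∈ → disjoint y∈ (∈-concat xss i x∈)
  ; {suc i} {suc j} x∈ y∈ → cong suc (inj x∈ y∈) }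

∈-tabulate : (f : Fin n → A) (i : Fin n) → f i ∈ tabulate f
∈-tabulate f zero    = here refl
∈-tabulate f (suc i) = there (∈-tabulate (f ∘ suc) i)

unique-tabulate : (f : Fin n → A) → Unique (tabulate f) → ∀ i j → f i ≡ f j → i ≡ j
unique-tabulate f (p ∷ u) zero    zero    eq = refl
unique-tabulate f (p ∷ u) zero    (suc j) eq = contradiction eq (All.lookup p (∈-tabulate (f ∘ suc) j))
unique-tabulate f (p ∷ u) (suc i) zero    eq = contradiction (sym eq) (All.lookup p (∈-tabulate (f ∘ suc) i))
unique-tabulate f (p ∷ u) (suc i) (suc j) eq = cong suc (unique-tabulate (f ∘ suc) u i j eq)

toList-lookup : (v : Vec A n) → tabulate (lookup v) ≡ toList v
toList-lookup []      = refl
toList-lookup (x ∷ v) = cong (x ∷_) (toList-lookup v)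

∈-toList : (v : Vec A n) (i : Fin n) → lookup v i ∈ toList v
∈-toList v i = subst (lookup v i ∈_) (toList-lookup v) (∈-tabulate (lookup v) i)

unique-lookup : (v : Vec A n) → Unique (toList v) → ∀ i j → lookup v i ≡ lookup v j → i ≡ j
unique-lookup v u = unique-tabulate (lookup v) (subst Unique (sym (toList-lookup v)) u)

module _ (As : Vec (Array r c) n) where

  cell : Fin n → Fin r → Fin c → ℤ
  cell I i j = lookup (lookup (cells (lookup As I)) i) j

  private
    ∈-rowLabels : ∀ I i j → ∣ cell I i j ∣ ∈ rowLabels (lookup (cells (lookup As I)) i)
    ∈-rowLabels I i j = subst (_∈ rowLabels v) (Vec.lookup-map j ∣_∣ v) (∈-toList (map ∣_∣ v) j)
      where v = lookup (cells (lookup As I)) i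

    ∈-row : ∀ I i j → ∣ cell I i j ∣ ∈ lookup (map rowLabels (cells (lookup As I))) i
    ∈-row I i j = subst (∣ cell I i j ∣ ∈_) (sym (Vec.lookup-map i rowLabels (cells (lookup As I)))) (∈-rowLabels I i j)

    ∈-labels : ∀ I i j → ∣ cell I i j ∣ ∈ lookup (map labels As) I
    ∈-labels I i j = subst (∣ cell I i j ∣ ∈_) (sym (Vec.lookup-map I labels As))
      (∈-concat (map rowLabels (cells (lookup As I))) i (∈-row I i j))

  ∈-allLabels : ∀ I i j → ∣ cell I i j ∣ ∈ allLabels As
  ∈-allLabels I i j = ∈-concat (map labels As) I (∈-labels I i j)

  -- A concatenation without repetition has disjoint members without repetition; so a label
  -- determines its array, then its row, then its column.
  cell-injective : Unique (allLabels As) → ∀ I i j I′ i′ j′ →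
                   ∣ cell I i j ∣ ≡ ∣ cell I′ i′ j′ ∣ → I ≡ I′ × i ≡ i′ × j ≡ j′
  cell-injective u I i j I′ i′ j′ eq
    with us , inj ← unique-concat (map labels As) u
    with refl ← inj (∈-labels I i j) (subst (_∈ lookup (map labels As) I′) (sym eq) (∈-labels I′ i′ j′))
    with us′ , inj′ ← unique-concat (map rowLabels (cells (lookup As I)))
                        (subst Unique (Vec.lookup-map I labels As) (us I))
    with refl ← inj′ (∈-row I i j) (subst (_∈ _) (sym eq) (∈-row I i′ j′))
    = refl , refl , unique-lookup (map ∣_∣ v)
        (subst Unique (Vec.lookup-map i rowLabels (cells (lookup As I))) (us′ i)) j j′
        (trans (Vec.lookup-map j ∣_∣ v) (trans eq (sym (Vec.lookup-map j′ ∣_∣ v))))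
    where v = lookup (cells (lookup As I)) i

length-rowLabels : (v : Vec ℤ c) → length (rowLabels v) ≡ c
length-rowLabels []      = refl
length-rowLabels (x ∷ v) = cong suc (length-rowLabels v)

length-matLabels : (M : Mat ℤ r c) → length (matLabels M) ≡ r * c
length-matLabels []      = refl
length-matLabels (v ∷ M) = trans (List.length-++ (rowLabels v)) (cong₂ _+_ (length-rowLabels v) (length-matLabels M))

length-allLabels : (As : Vec (Array r c) n) → length (allLabels As) ≡ n * (r * c)
length-allLabels []       = refl
length-allLabels (A ∷ As) = trans (List.length-++ (labels A)) (cong₂ _+_ (length-matLabels (cells A)) (length-allLabels As))

-- Lines cut into blocks, and their rotations

tabulate-+ : ∀ m {n} (f : Fin (m + n) → A) →
             tabulate f ≡ tabulate (f ∘ (_↑ˡ n)) ++ tabulate (f ∘ (m ↑ʳ_))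
tabulate-+ zero    f = refl
tabulate-+ (suc m) f = cong (f zero ∷_) (tabulate-+ m (f ∘ suc))

tabulate-* : ∀ m {n} (f : Fin (m * n) → A) →
             tabulate f ≡ List.concat (tabulate λ i → tabulate λ j → f (combine {m} {n} i j))
tabulate-* zero        f = refl
tabulate-* (suc m) {n} f =
  trans (tabulate-+ n f) (cong (tabulate (f ∘ (_↑ˡ m * n)) ++_) (tabulate-* m (f ∘ (n ↑ʳ_))))

entries-* : ∀ m {n} (f : Fin m × Fin n → Maybe ℤ) →
            entries (f ∘ remQuot n) ≡ List.concat (tabulate λ i → entries λ j → f (i , j))
entries-* m {n} f = begin
  catMaybes (tabulate (f ∘ remQuot n)) ≡⟨ cong catMaybes (tabulate-* m _) ⟩
  catMaybes (List.concat (tabulate λ i → tabulate λ j → f (remQuot n (combine {m} i j))))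
    ≡⟨ cong (catMaybes ∘ List.concat) (List.tabulate-cong λ i → List.tabulate-cong λ j →
         cong f (Fin.remQuot-combine {m} i j)) ⟩
  catMaybes (List.concat (tabulate λ i → tabulate λ j → f (i , j))) ≡⟨ go m _ ⟩
  List.concat (tabulate λ i → entries λ j → f (i , j)) ∎
  where
  open ≡-Reasoning
  go : ∀ m (F : Fin m → List (Maybe ℤ)) →
       catMaybes (List.concat (tabulate F)) ≡ List.concat (tabulate (catMaybes ∘ F))
  go zero    F = refl
  go (suc m) F = trans (List.catMaybes-++ (F zero) _) (cong (catMaybes (F zero) ++_) (go m (F ∘ suc)))

applyUpTo-toℕ : ∀ n (f : ℕ → A) → tabulate {n = n} (f ∘ toℕ) ≡ applyUpTo f n
applyUpTo-toℕ zero    f = refl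
applyUpTo-toℕ (suc n) f = cong (f 0 ∷_) (applyUpTo-toℕ n (f ∘ suc))

-- Put f 0 in front of both lists: the left one becomes f 0, ..., f n, whose last term equals f 0.
rotate₁ : ∀ n (f : ℕ → A) → f n ≡ f 0 → applyUpTo (f ∘ suc) n ↭ applyUpTo f n
rotate₁ n f eq = ↭.drop-∷ (begin
  f 0 ∷ applyUpTo (f ∘ suc) n   ≡⟨ List.applyUpTo-∷ʳ f n ⟨
  applyUpTo f n ++ [ f n ]      ↭⟨ ↭.∷↭∷ʳ (f n) (applyUpTo f n) ⟨
  f n ∷ applyUpTo f n           ≡⟨ cong (_∷ applyUpTo f n) eq ⟩
  f 0 ∷ applyUpTo f n           ∎)
  where open PermutationReasoning

-- Along a block row or block column the slots appear cyclically shifted. Lengths and sums of lines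
-- do not see the shift.
rotate : ∀ n .{{_ : NonZero n}} i (f : Fin n → A) →
         tabulate (λ j → f ((i + toℕ j) mod n)) ↭ tabulate f
rotate {A = A} n i f = begin
  tabulate (λ j → f ((i + toℕ j) mod n))   ≡⟨ applyUpTo-toℕ n (λ j → f ((i + j) mod n)) ⟩
  applyUpTo (λ j → f ((i + j) mod n)) n    ↭⟨ go i ⟩
  applyUpTo (λ j → f (j mod n)) n          ≡⟨ applyUpTo-toℕ n (λ j → f (j mod n)) ⟨
  tabulate (λ j → f (toℕ j mod n))         ≡⟨ List.tabulate-cong (λ j → cong f (toℕ-mod j)) ⟩
  tabulate f                               ∎
  where
  open PermutationReasoning
  toℕ-mod : (j : Fin n) → toℕ j mod n ≡ j
  toℕ-mod j = Fin.toℕ-injective (trans (Fin.toℕ-fromℕ< (m%n<n (toℕ j) n)) (m<n⇒m%n≡m (Fin.toℕ<n j)))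
  mod-cong : ∀ {x y} → x % n ≡ y % n → x mod n ≡ y mod n
  mod-cong {x} {y} eq = Fin.fromℕ<-cong _ _ eq (m%n<n x n) (m%n<n y n)
  go : ∀ i → applyUpTo (λ j → f ((i + j) mod n)) n ↭ applyUpTo (λ j → f (j mod n)) n
  go zero    = ↭-refl
  go (suc i) = ↭-trans (↭-reflexive (applyUpTo-cong n (λ j → cong (λ x → f (x mod n)) (sym (ℕ.+-suc i j)))))
    (↭-trans (rotate₁ n (λ j → f ((i + j) mod n))
               (cong f (mod-cong (trans ([m+n]%n≡m%n i n) (cong (_% n) (sym (ℕ.+-identityʳ i)))))))
             (go i))
    where
    applyUpTo-cong : ∀ n {f g : ℕ → A} → (∀ i → f i ≡ g i) → applyUpTo f n ≡ applyUpTo g n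
    applyUpTo-cong zero    eq = refl
    applyUpTo-cong (suc n) eq = cong₂ _∷_ (eq 0) (applyUpTo-cong n (eq ∘ suc))

sumℤ-++ : ∀ xs ys → sumℤ (xs ++ ys) ≡ sumℤ xs ℤ.+ sumℤ ys
sumℤ-++ []       ys = sym (ℤ.+-identityˡ _)
sumℤ-++ (x ∷ xs) ys = trans (cong (ℤ._+_ x) (sumℤ-++ xs ys)) (sym (ℤ.+-assoc x (sumℤ xs) (sumℤ ys)))

sumℤ-↭ : ∀ {xs ys} → xs ↭ ys → sumℤ xs ≡ sumℤ ys
sumℤ-↭ p = ↭ₛ.foldr-commMonoid (setoid ℤ) ℤ.+-0-isCommutativeMonoid (↭⇒↭ₛ p)

sumℤ-concat : ∀ n (F : Fin n → List ℤ) → (∀ i → sumℤ (F i) ≡ 0ℤ) → sumℤ (List.concat (tabulate F)) ≡ 0ℤ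
sumℤ-concat zero    F z = refl
sumℤ-concat (suc n) F z = trans (sumℤ-++ (F zero) _) (cong₂ ℤ._+_ (z zero) (sumℤ-concat n (F ∘ suc) (z ∘ suc)))

length-concat : ∀ n (F : Fin n → List A) → length (List.concat (tabulate F)) ≡ sum (tabulate (length ∘ F))
length-concat zero    F = refl
length-concat (suc n) F = trans (List.length-++ (F zero)) (cong (length (F zero) +_) (length-concat n (F ∘ suc)))

entries-just : ∀ n (f : Fin n → ℤ) → entries (just ∘ f) ≡ tabulate f
entries-just zero    f = refl
entries-just (suc n) f = cong (f zero ∷_) (entries-just n (f ∘ suc))

entries-nothing : ∀ n → entries {n} (λ _ → nothing) ≡ []
entries-nothing zero    = refl
entries-nothing (suc n) = entries-nothing n

concat-[] : ∀ n → List.concat (tabulate {A = List A} {n = n} (λ _ → [])) ≡ []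
concat-[] zero    = refl
concat-[] (suc n) = concat-[] n

sum-tabulate-lookup : (v : Vec ℤ n) → sumℤ (tabulate (lookup v)) ≡ foldr′ ℤ._+_ 0ℤ v
sum-tabulate-lookup []      = refl
sum-tabulate-lookup (x ∷ v) = cong (ℤ._+_ x) (sum-tabulate-lookup v)

row-sum-zero : (A : Array r c) (i : Fin r) → sumℤ (tabulate (lookup (lookup (cells A) i))) ≡ 0ℤ
row-sum-zero {r} (mkArray M rz _) i = begin
  sumℤ (tabulate (lookup (lookup M i))) ≡⟨ sum-tabulate-lookup (lookup M i) ⟩
  foldr′ ℤ._+_ 0ℤ (lookup M i)          ≡⟨ Vec.lookup-map i _ M ⟨
  lookup (rowSums M) i                  ≡⟨ cong (λ v → lookup v i) rz ⟩
  lookup (replicate r 0ℤ) i             ≡⟨ Vec.lookup-replicate i 0ℤ ⟩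
  0ℤ                                    ∎
  where open ≡-Reasoning

col-sum-zero : (A : Array r c) (j : Fin c) → sumℤ (tabulate λ i → lookup (lookup (cells A) i) j) ≡ 0ℤ
col-sum-zero {c = c} (mkArray M _ cz) j = begin
  sumℤ (tabulate λ i → lookup (lookup M i) j) ≡⟨ go M ⟩
  lookup (colSums M) j                        ≡⟨ cong (λ v → lookup v j) cz ⟩
  lookup (replicate c 0ℤ) j                   ≡⟨ Vec.lookup-replicate j 0ℤ ⟩
  0ℤ                                          ∎
  where
  open ≡-Reasoning
  go : ∀ {r} (M : Mat ℤ r c) → sumℤ (tabulate λ i → lookup (lookup M i) j) ≡ lookup (colSums M) j
  go []      = sym (Vec.lookup-replicate j 0ℤ)
  go (v ∷ M) = trans (cong (ℤ._+_ (lookup v j)) (go M)) (sym (Vec.lookup-zipWith ℤ._+_ j v (colSums M)))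

-- By `rotate` the values are a permutation of `allFin n`, which has no repetition.
mod-injective : ∀ n .{{_ : NonZero n}} i (j j′ : Fin n) → (i + toℕ j) mod n ≡ (i + toℕ j′) mod n → j ≡ j′
mod-injective n i = unique-tabulate (λ j → (i + toℕ j) mod n)
  (↭ₛ.Unique-resp-↭ (setoid (Fin n)) (↭⇒↭ₛ (↭-sym (rotate n i id))) (allFin⁺ n))

-- The I-th array goes to block row I, and there to the g block columns J with (I + J) mod (g + h) < g.

module _ {a t g h : ℕ} .{{_ : NonZero (g + h)}} (As : Vec (Array a (g * t)) (g + h)) where
  private
    slot : Fin (g + h) → Fin (g + h) → Fin (g + h)
    slot I J = (toℕ I + toℕ J) mod (g + h)

    -- The slots below g hold the g pieces of t consecutive columns into which an array of width g t
    -- is cut; the other h slots stay empty.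
    inSlot : Fin (g + h) → Fin a → Fin (g + h) → Fin t → Maybe ℤ
    inSlot I r s e = [ (λ s → just (cell As I r (combine s e))) , (λ _ → nothing) ]′ (splitAt g s)

    atBlock : Fin (g + h) × Fin a → Fin (g + h) × Fin t → Maybe ℤ
    atBlock (I , r) (J , e) = inSlot I r (slot I J) e

  placed : PartialArray ((g + h) * a) ((g + h) * t)
  placed i j = atBlock (remQuot a i) (remQuot t j)

  private
    slot-entries : ∀ I r s → List ℤ
    slot-entries I r s = entries (inSlot I r s)

    row-entries : ∀ I r → List.concat (tabulate (slot-entries I r)) ≡
                          tabulate (lookup (lookup (cells (lookup As I)) r))
    row-entries I r = begin
      List.concat (tabulate (slot-entries I r)) ≡⟨ cong List.concat (tabulate-+ g (slot-entries I r)) ⟩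
      List.concat (tabulate (slot-entries I r ∘ (_↑ˡ h)) ++ tabulate (slot-entries I r ∘ (g ↑ʳ_)))
        ≡⟨ cong₂ (λ xss yss → List.concat (xss ++ yss)) (List.tabulate-cong full) (List.tabulate-cong empty) ⟩
      List.concat (tabulate blockRow ++ tabulate (λ _ → [])) ≡⟨ List.concat-++ (tabulate blockRow) _ ⟨
      List.concat (tabulate blockRow) ++ List.concat (tabulate {n = h} (λ _ → []))
        ≡⟨ cong (List.concat (tabulate blockRow) ++_) (concat-[] h) ⟩
      List.concat (tabulate blockRow) ++ [] ≡⟨ List.++-identityʳ _ ⟩
      List.concat (tabulate blockRow) ≡⟨ tabulate-* g (cell As I r) ⟨
      tabulate (cell As I r) ∎
      where
      open ≡-Reasoning
      blockRow : Fin g → List ℤ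
      blockRow s = tabulate λ e → cell As I r (combine s e)
      full : ∀ s → slot-entries I r (s ↑ˡ h) ≡ blockRow s
      full s rewrite Fin.splitAt-↑ˡ g s h = entries-just t _
      empty : ∀ s → slot-entries I r (g ↑ʳ s) ≡ []
      empty s rewrite Fin.splitAt-↑ʳ g h s = entries-nothing t

    row-↭ : ∀ i → let I , r = remQuot a i in
            entries (placed i) ↭ tabulate (lookup (lookup (cells (lookup As I)) r))
    row-↭ i = let I , r = remQuot a i in ↭-trans
      (↭-reflexive (entries-* (g + h) (atBlock (I , r))))
      (↭-trans (concat-↭ (rotate (g + h) (toℕ I) (slot-entries I r))) (↭-reflexive (row-entries I r)))

    -- A column of the large array meets block row I in a complete column of the I-th array or not
    -- at all. Its sum is therefore zero, and its length is a times the number of nonempty slots.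
    col-entries : Fin t → Fin (g + h) → Fin (g + h) → List ℤ
    col-entries e I s = entries λ r → inSlot I r s e

    height : Fin (g + h) → ℕ
    height s = [ (λ _ → a) , (λ _ → 0) ]′ (splitAt g s)

    col-length : ∀ e I s → length (col-entries e I s) ≡ height s
    col-length e I s with splitAt g s
    ... | inj₁ s′ = trans (cong length (entries-just a _)) (List.length-tabulate _)
    ... | inj₂ _  = cong length (entries-nothing a)

    col-zero : ∀ e I s → sumℤ (col-entries e I s) ≡ 0ℤ
    col-zero e I s with splitAt g s
    ... | inj₁ s′ = trans (cong sumℤ (entries-just a _)) (col-sum-zero (lookup As I) (combine s′ e))
    ... | inj₂ _  = cong sumℤ (entries-nothing a)

    col≡ : ∀ j → let J , e = remQuot t j in
           entries (Vector.transpose placed j) ≡ List.concat (tabulate λ I → col-entries e I (slot I J))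
    col≡ j = let J , e = remQuot t j in entries-* (g + h) (λ Ir → atBlock Ir (J , e))

    sum-heights : sum (tabulate height) ≡ g * a
    sum-heights = begin
      sum (tabulate height) ≡⟨ cong sum (tabulate-+ g height) ⟩
      sum (tabulate (height ∘ (_↑ˡ h)) ++ tabulate (height ∘ (g ↑ʳ_)))
        ≡⟨ cong₂ (λ xs ys → sum (xs ++ ys)) (List.tabulate-cong full) (List.tabulate-cong empty) ⟩
      sum (tabulate {n = g} (λ _ → a) ++ tabulate {n = h} (λ _ → 0)) ≡⟨ go g ⟩
      g * a ∎
      where
      open ≡-Reasoning
      full : ∀ s → height (s ↑ˡ h) ≡ a
      full s rewrite Fin.splitAt-↑ˡ g s h = refl
      empty : ∀ s → height (g ↑ʳ s) ≡ 0
      empty s rewrite Fin.splitAt-↑ʳ g h s = refl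
      zeros : ∀ h → sum (tabulate {n = h} (λ _ → 0)) ≡ 0
      zeros zero    = refl
      zeros (suc h) = zeros h
      go : ∀ g → sum (tabulate {n = g} (λ _ → a) ++ tabulate {n = h} (λ _ → 0)) ≡ g * a
      go zero    = zeros h
      go (suc g) = cong (a +_) (go g)

    just-injective : ∀ I r s e {x} → inSlot I r s e ≡ just x →
                     ∃ λ s′ → s ≡ s′ ↑ˡ h × x ≡ cell As I r (combine s′ e)
    just-injective I r s e eq with splitAt g s in eq′
    just-injective I r s e refl | inj₁ s′ = s′ , sym (Fin.splitAt⁻¹-↑ˡ eq′) , refl
    just-injective I r s e ()   | inj₂ _

    remQuot-injective : ∀ {m} n (i j : Fin (m * n)) → remQuot n i ≡ remQuot {m} n j → i ≡ j
    remQuot-injective {m} n i j eq = trans (sym (Fin.combine-remQuot {m} n i))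
      (trans (cong (uncurry combine) eq) (Fin.combine-remQuot {m} n j))

  placed-isHeffter : ∀ {N} → allLabels As ↭ interval 1 N → IsHeffter (g * t) (g * a) placed
  placed-isHeffter {N} covers = record
    { range      = range
    ; row-filled = λ i → trans (↭.↭-length (row-↭ i)) (List.length-tabulate _)
    ; col-filled = λ j → let J , e = remQuot t j in begin
        length (entries (Vector.transpose placed j)) ≡⟨ cong length (col≡ j) ⟩
        length (List.concat (tabulate λ I → col-entries e I (slot I J))) ≡⟨ length-concat (g + h) _ ⟩
        sum (tabulate λ I → length (col-entries e I (slot I J)))
          -- A slot depends on I + J only, so for fixed J it runs through a rotation as I varies.
          ≡⟨ cong sum (List.tabulate-cong λ I → trans (col-length e I (slot I J))
               (cong (λ x → height (x mod (g + h))) (ℕ.+-comm (toℕ I) (toℕ J)))) ⟩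
        sum (tabulate {n = g + h} λ I → height ((toℕ J + toℕ I) mod (g + h)))
          ≡⟨ sum-↭ (rotate (g + h) (toℕ J) height) ⟩
        sum (tabulate height) ≡⟨ sum-heights ⟩
        g * a ∎
    ; distinct   = distinct
    ; row-sum    = λ i → let I , r = remQuot {g + h} a i in
        trans (sumℤ-↭ (row-↭ i)) (row-sum-zero (lookup As I) r)
    ; col-sum    = λ j → let J , e = remQuot t j in
        trans (cong sumℤ (col≡ j)) (sumℤ-concat (g + h) _ λ I → col-zero e I (slot I J))
    }
    where
    open ≡-Reasoning
    size : N ≡ (g + h) * t * (g * a)
    size = begin
      N                          ≡⟨ length-interval 1 N ⟨
      length (interval 1 N)      ≡⟨ ↭.↭-length covers ⟨
      length (allLabels As)      ≡⟨ length-allLabels As ⟩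
      (g + h) * (a * (g * t))    ≡⟨ lemma (g + h) a g t ⟩
      (g + h) * t * (g * a)      ∎
      where
      lemma : ∀ c a g t → c * (a * (g * t)) ≡ c * t * (g * a)
      lemma = solve-∀
    range : ∀ i j {x} → placed i j ≡ just x → 1 ≤ ∣ x ∣ × ∣ x ∣ ≤ (g + h) * t * (g * a)
    range i j eq with _ , _ , refl ← just-injective _ _ _ _ eq =
      All.lookup (interval-≥ 1 N) x∈ , subst (_ ≤_) size (s≤s⁻¹ (All.lookup (interval-< 1 N) x∈))
      where x∈ = ↭.∈-resp-↭ covers (∈-allLabels As _ _ _)
    unique : Unique (allLabels As)
    unique = ↭ₛ.Unique-resp-↭ (setoid ℕ) (↭⇒↭ₛ (↭-sym covers)) (interval-unique 1 N)
    -- The label gives I, r and the column within the I-th array, hence the slot s and e; then J is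
    -- recovered from s because I is known.
    atBlock-distinct : ∀ I r J e I′ r′ J′ e′ {x y} → atBlock (I , r) (J , e) ≡ just x → atBlock (I′ , r′) (J′ , e′) ≡ just y →
                  ∣ x ∣ ≡ ∣ y ∣ → (I , r) ≡ (I′ , r′) × (J , e) ≡ (J′ , e′)
    atBlock-distinct I r J e I′ r′ J′ e′ eqx eqy eq
      with s , s≡ , refl ← just-injective I r (slot I J) e eqx
         | s′ , s′≡ , refl ← just-injective I′ r′ (slot I′ J′) e′ eqy
      with refl , refl , se≡ ← cell-injective As unique I r (combine s e) I′ r′ (combine s′ e′) eq
      with refl , refl ← Fin.combine-injective s e s′ e′ se≡
      with refl ← mod-injective (g + h) (toℕ I) J J′ (trans s≡ (sym s′≡))
      = refl , refl
    distinct : ∀ i j i′ j′ {x y} → placed i j ≡ just x → placed i′ j′ ≡ just y →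
               ∣ x ∣ ≡ ∣ y ∣ → i ≡ i′ × j ≡ j′
    distinct i j i′ j′ eqx eqy eq =
      let i≡ , j≡ = atBlock-distinct _ _ _ _ _ _ _ _ eqx eqy eq in
      remQuot-injective {g + h} a i i′ i≡ , remQuot-injective {g + h} t j j′ j≡

-- Assembling the a × s arrays

square : FormArray 2 4 4
square = formArray
  ( (+′ 0 ∷ -′ 1 ∷ -′ 4 ∷ +′ 5 ∷ [])
  ∷ (-′ 2 ∷ +′ 3 ∷ +′ 6 ∷ -′ 7 ∷ [])
  ∷ (-′ 8 ∷ +′ 9 ∷ +′ 12 ∷ -′ 13 ∷ [])
  ∷ (+′ 10 ∷ -′ 11 ∷ -′ 14 ∷ +′ 15 ∷ []) ∷ []) refl refl
  where
  +′ -′ : ℕ → Sign × Form 2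
  +′ i = Sign.+ , ℓ 1 i
  -′ i = Sign.- , ℓ 1 i

squareAt : ∀ s → Σ (Array 4 4) λ A → labels A ↭ interval s 16
squareAt s = evaluate ρ square , (begin
  labels (evaluate ρ square)        ≡⟨ ⟦points⟧ (s ∷ []) square ⟨
  ⟦ points square ⟧* ρ              ↭⟨ ⟦↭⟧ ρ (from-just (permutation? _≟ⁱ_ (points square) run16)) ⟩
  ⟦ run16 ⟧* ρ                      ≡⟨ ⟦tile⟧ ρ (ℓ 1 0) (singles 16) ⟩
  interval (1 * s + 0) 16           ≡⟨ cong (λ s → interval s 16) (trans (ℕ.+-identityʳ _) (ℕ.*-identityˡ s)) ⟩
  interval s 16                     ∎)
  where
  open PermutationReasoning
  ρ : Vec ℕ 2
  ρ = 1 ∷ s ∷ []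
  run16 : List (Span 2)
  run16 = tile (ℓ 1 0) (singles 16)

squares : ∀ n s → Σ (Vec (Array 4 4) n) λ As → allLabels As ↭ interval s (n * 16)
squares zero    s = [] , ↭-refl
squares (suc n) s with A , e ← squareAt s | As , es ← squares n (s + 16) =
  A ∷ As , ↭-trans (↭.++⁺ e es) (↭-reflexive (sym (interval-+ s 16 (n * 16))))

module _ (w e f i j b s₃ s₄ c : ℕ) where
  private
    strip₃ : e * w + f * 4 ≡ b → (As : Vec (Array 3 w) e) (Bs : Vec (Array 3 4) f) →
             Σ (Array 3 b) λ C → labels C ↭ allLabels As ++ allLabels Bs
    strip₃ refl As Bs = beside (row As) (row Bs) ,
      ↭-trans (labels-beside (row As) (row Bs)) (↭.++⁺ (labels-row As) (labels-row Bs))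
    strip₄ : i * 3 + j * 4 ≡ b → (As : Vec (Array 3 4) i) (Bs : Vec (Array 4 4) j) →
             Σ (Array 4 b) λ C → labels C ↭ allLabels As ++ allLabels Bs
    strip₄ refl As Bs = beside (row (map _ᵀ As)) (row Bs) ,
      ↭-trans (labels-beside (row (map _ᵀ As)) (row Bs))
        (↭.++⁺ (↭-trans (labels-row (map _ᵀ As)) (allLabels-ᵀ As)) (labels-row Bs))
    block : (As : Vec (Array 3 b) s₃) (Bs : Vec (Array 4 b) s₄) →
            Σ (Array (s₃ * 3 + s₄ * 4) b) λ C → labels C ↭ allLabels As ++ allLabels Bs
    block As Bs = above (stack As) (stack Bs) , ↭-reflexive
      (trans (labels-above (stack As) (stack Bs)) (cong₂ _++_ (labels-stack As) (labels-stack Bs)))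

  -- A strip of 3 rows consists of e wide and f narrow arrays, a strip of 4 rows of i transposed
  -- narrow arrays and j squares. Each of the c arrays has `s₃` strips of the first sort and `s₄` of
  -- the second.
  assemble : e * w + f * 4 ≡ b → i * 3 + j * 4 ≡ b →
             Packing w (c * s₃ * e) (c * s₃ * f + c * s₄ * i) →
             Σ (Vec (Array (s₃ * 3 + s₄ * 4) b) c) λ As → ∃ λ N → allLabels As ↭ interval 1 N
  assemble b≡ b≡′ (N , supply wide narrow covers)
    with narrow₁ , narrow₂ , refl ← Vec.splitAt (c * s₃ * f) narrow
    -- The squares take the integers that follow the packing, from N + 1 on.
    with quads , quads↭ ← squares (c * s₄ * j) (1 + N)
    with strips₃ , strips₃↭ ← portions (strip₃ b≡) (c * s₃) wide narrow₁
       | strips₄ , strips₄↭ ← portions (strip₄ b≡′) (c * s₄) narrow₂ quads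
    with As , As↭ ← portions block c strips₃ strips₄ = As , _ , (begin
      allLabels As                                        ↭⟨ As↭ ⟩
      allLabels strips₃ ++ allLabels strips₄              ↭⟨ ↭.++⁺ strips₃↭ strips₄↭ ⟩
      (W ++ N₁) ++ (N₂ ++ Q)                              ≡⟨ List.++-assoc W N₁ _ ⟩
      W ++ N₁ ++ N₂ ++ Q                                  ≡⟨ cong (W ++_) (List.++-assoc N₁ N₂ Q) ⟨
      W ++ (N₁ ++ N₂) ++ Q                                ≡⟨ List.++-assoc W _ Q ⟨
      (W ++ N₁ ++ N₂) ++ Q                                ≡⟨ cong (λ L → (W ++ L) ++ Q) (allLabels-++ narrow₁ narrow₂) ⟨
      (W ++ allLabels (narrow₁ Vec.++ narrow₂)) ++ Q      ↭⟨ ↭.++⁺ covers quads↭ ⟩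
      interval 1 N ++ interval (1 + N) (c * s₄ * j * 16)  ≡⟨ interval-+ 1 N _ ⟨
      interval 1 (N + c * s₄ * j * 16)                    ∎)
    where
    open PermutationReasoning
    W = allLabels wide ; N₁ = allLabels narrow₁ ; N₂ = allLabels narrow₂ ; Q = allLabels quads

-- Residue classes of height and width

HeffterSet : ℕ → ℕ → ℕ → Set
HeffterSet a b c = Σ (Vec (Array a b) c) λ As → ∃ λ N → allLabels As ↭ interval 1 N

-- The index of height is the number of strips of 3 rows, that of width the residue mod 4.
data Height : ℕ → Set where
  height₁ : ∀ x → Height (1 * 3 + suc x * 4)
  height₃ : ∀ x → Height (3 * 3 + x * 4)

data Width : ℕ → Set where
  width₀ : ∀ y → Width (4 + y * 4)
  width₃ : ∀ y → Width (7 + y * 4)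
  width₁ : ∀ y → Width (9 + y * 4)
  width₂ : ∀ y → Width (14 + y * 4)

-- An odd number from 7 on is 3 + 4 (x + 1) or 9 + 4 x, according to its residue 3 or 1 mod 4.
height : ∀ a → ¬ (2 ∣ a) → 7 ≤ a → Height a
height a odd 7≤a = go (a % 4) (a / 4) (m%n<n a 4) (m≡m%n+[m/n]*n a 4)
  where
  go : ∀ r q → r < 4 → a ≡ r + q * 4 → Height a
  go 0 q _ refl = contradiction (divides (q * 2) (lemma q)) odd
    where lemma : ∀ q → q * 4 ≡ q * 2 * 2
          lemma = solve-∀
  go 1 0 _ refl = contradiction 7≤a λ { (s≤s ()) }
  go 1 1 _ refl = contradiction 7≤a λ { (s≤s (s≤s (s≤s (s≤s (s≤s ()))))) }
  go 1 (suc (suc q)) _ refl = height₃ q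
  go 2 q _ refl = contradiction (divides (1 + q * 2) (lemma q)) odd
    where lemma : ∀ q → 2 + q * 4 ≡ (1 + q * 2) * 2
          lemma = solve-∀
  go 3 0 _ refl = contradiction 7≤a λ { (s≤s (s≤s (s≤s ()))) }
  go 3 (suc q) _ refl = height₁ q
  go (suc (suc (suc (suc _)))) _ (s≤s (s≤s (s≤s (s≤s ())))) _

-- Sums of fours together with nothing, one 7, one 9 or two 7s, and at least one summand, reach
-- every number from 3 on except 3, 5, 6 and 10.
width : ∀ b → 3 ≤ b → b ∉ 3 ∷ 5 ∷ 6 ∷ 10 ∷ [] → Width b
width b 3≤b b∉ = go (b % 4) (b / 4) (m%n<n b 4) (m≡m%n+[m/n]*n b 4)
  where
  go : ∀ r q → r < 4 → b ≡ r + q * 4 → Width b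
  go 0 0 _ refl = contradiction 3≤b λ ()
  go 0 (suc q) _ refl = width₀ q
  go 1 0 _ refl = contradiction 3≤b λ { (s≤s ()) }
  go 1 1 _ refl = contradiction (there (here refl)) b∉
  go 1 (suc (suc q)) _ refl = width₁ q
  go 2 0 _ refl = contradiction 3≤b λ { (s≤s (s≤s ())) }
  go 2 1 _ refl = contradiction (there (there (here refl))) b∉
  go 2 2 _ refl = contradiction (there (there (there (here refl)))) b∉
  go 2 (suc (suc (suc q))) _ refl = width₂ q
  go 3 0 _ refl = contradiction (here refl) b∉
  go 3 (suc q) _ refl = width₃ q
  go (suc (suc (suc (suc _)))) _ (s≤s (s≤s (s≤s (s≤s ())))) _

-- Modulo 4 only the number i of 3 × 7 or 3 × 9 arrays matters, as 3 · 7 ≡ 1 and 3 · 9 ≡ 3.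

Admissible : ℕ → Set
Admissible n = n % 4 ≡ 0 ⊎ n % 4 ≡ 3

residue₇ : ∀ i K {n} → n ≡ i + K * 4 → Admissible n → i % 4 ≡ 3 ⊎ i % 4 ≡ 0
residue₇ i K refl ok with Sum.swap ok
... | inj₁ eq = inj₁ (trans (sym ([m+kn]%n≡m%n i K 4)) eq)
... | inj₂ eq = inj₂ (trans (sym ([m+kn]%n≡m%n i K 4)) eq)

residue₉ : ∀ i K {n} → n ≡ 3 * i + K * 4 → Admissible n → i % 4 ≡ 1 ⊎ i % 4 ≡ 0
residue₉ i K refl ok = go (i % 4) (m%n<n i 4) (Sum.map reduce reduce ok)
  where
  reduce : ∀ {r} → (3 * i + K * 4) % 4 ≡ r → (3 * (i % 4)) % 4 ≡ r
  reduce eq = trans (sym (trans ([m+kn]%n≡m%n (3 * i) K 4) (%-distribˡ-* 3 i 4))) eq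
  go : ∀ r → r < 4 → Admissible (3 * r) → r ≡ 1 ⊎ r ≡ 0
  go 0 _ _ = inj₂ refl
  go 1 _ _ = inj₁ refl
  go 2 _ (inj₁ ())
  go 2 _ (inj₂ ())
  go 3 _ (inj₁ ())
  go 3 _ (inj₂ ())
  go (suc (suc (suc (suc _)))) (s≤s (s≤s (s≤s (s≤s ())))) _

-- The cofactor of c is odd. It will be the number of 3-row strips in an array, which is 1 or 3.
even-copies : ∀ c x → 2 ∣ c * (1 + x * 2) → 2 ∣ c
even-copies c x 2∣ = ∣m+n∣m⇒∣n {m = c * x * 2} (subst (2 ∣_) (lemma c x) 2∣) (n∣m*n (c * x))
  where
  lemma : ∀ c x → c * (1 + x * 2) ≡ c * x * 2 + c
  lemma = solve-∀

module _ (c x s₄ e f i j b : ℕ) (0<c : 0 < c) (0<e : 0 < e) (i≡ : i * 3 + j * 4 ≡ b)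
         (half : 4 ∣ c * (1 + x * 2) * e → 2 ∣ c * (1 + x * 2)) where
  private
    s₃ = 1 + x * 2
    wides narrows : ℕ
    wides   = c * s₃ * e
    narrows = c * s₃ * f + c * s₄ * i

    some : 0 < wides + narrows
    some = ℕ.<-≤-trans (ℕ.*-mono-≤ (ℕ.*-mono-≤ 0<c (s≤s z≤n)) 0<e) (ℕ.m≤m+n wides narrows)

    -- Divisibility of `wides` by 4 makes c even, and c divides both summands of `narrows`. This
    -- supplies the parity that the packings ask for in the class 0 mod 4.
    2∣narrows : wides % 4 ≡ 0 → 2 ∣ narrows
    2∣narrows eq = ∣m∣n⇒∣m+n (∣m⇒∣m*n f (∣m⇒∣m*n s₃ 2∣c)) (∣m⇒∣m*n i (∣m⇒∣m*n s₄ 2∣c))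
      where 2∣c = even-copies c x (half (m%n≡0⇒n∣m wides 4 eq))

  withSevens : e * 7 + f * 4 ≡ b → Admissible (c * ((s₃ * 3 + s₄ * 4) * b)) → HeffterSet (s₃ * 3 + s₄ * 4) b c
  withSevens e≡ ok = assemble 7 e f i j b s₃ s₄ c e≡ i≡ (packing₇ wides narrows
    (Sum.map₂ (λ eq → eq , 2∣narrows eq)
      -- Of the c a b cells, 21 `wides` lie in wide arrays, and 21 = 1 + 5 · 4; all the other cells
      -- come in multiples of 4.
      (residue₇ wides (5 * wides + 3 * (c * s₃ * f) + c * s₄ * (e * 7 + f * 4))
        (trans (cong (λ b → c * ((s₃ * 3 + s₄ * 4) * b)) (sym e≡)) (lemma c s₃ s₄ e f)) ok)) some)
    where
    lemma : ∀ c s₃ s₄ e f → c * ((s₃ * 3 + s₄ * 4) * (e * 7 + f * 4)) ≡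
            c * s₃ * e + (5 * (c * s₃ * e) + 3 * (c * s₃ * f) + c * s₄ * (e * 7 + f * 4)) * 4
    lemma = solve-∀

  withNines : e * 9 + f * 4 ≡ b → Admissible (c * ((s₃ * 3 + s₄ * 4) * b)) → HeffterSet (s₃ * 3 + s₄ * 4) b c
  withNines e≡ ok = assemble 9 e f i j b s₃ s₄ c e≡ i≡ (packing₉ wides narrows
    (Sum.map₂ (λ eq → eq , 2∣narrows eq)
      (residue₉ wides (6 * wides + 3 * (c * s₃ * f) + c * s₄ * (e * 9 + f * 4))
        (trans (cong (λ b → c * ((s₃ * 3 + s₄ * 4) * b)) (sym e≡)) (lemma c s₃ s₄ e f)) ok)) some)
    where
    lemma : ∀ c s₃ s₄ e f → c * ((s₃ * 3 + s₄ * 4) * (e * 9 + f * 4)) ≡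
            3 * (c * s₃ * e) + (6 * (c * s₃ * e) + 3 * (c * s₃ * f) + c * s₄ * (e * 9 + f * 4)) * 4
    lemma = solve-∀

-- For strips of 3 and of 4 rows, the width splits as 7 + 4 y = 3 + 4 (y + 1), as 9 + 4 y = 3 · 3 +
-- 4 y, and as 2 · 7 + 4 y = 2 · 3 + 4 (y + 2); a multiple of 4 is cut into fours in both.
heffterSet′ : ∀ c x s₄ {b} → 0 < c → Width b →
              Admissible (c * (((1 + x * 2) * 3 + s₄ * 4) * b)) → HeffterSet ((1 + x * 2) * 3 + s₄ * 4) b c
heffterSet′ c x s₄ 0<c (width₀ y) _ =
  assemble 7 0 (suc y) 0 (suc y) _ (1 + x * 2) s₄ c refl refl
    (subst (λ i → Packing 7 i narrows) (sym (ℕ.*-zeroʳ (c * (1 + x * 2)))) (packing₄ narrows 0<narrows))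
  where
  narrows = c * (1 + x * 2) * suc y + c * s₄ * 0
  0<narrows : 0 < narrows
  0<narrows = ℕ.<-≤-trans (ℕ.*-mono-≤ (ℕ.*-mono-≤ 0<c (s≤s z≤n)) (s≤s z≤n)) (ℕ.m≤m+n _ (c * s₄ * 0))
heffterSet′ c x s₄ 0<c (width₃ y) =
  withSevens c x s₄ 1 y 1 (suc y) _ 0<c (s≤s z≤n) refl
    (λ 4∣ → ∣-trans (divides 2 refl) (subst (4 ∣_) (ℕ.*-identityʳ _) 4∣)) refl
heffterSet′ c x s₄ 0<c (width₁ y) =
  withNines c x s₄ 1 y 3 y _ 0<c (s≤s z≤n) refl
    (λ 4∣ → ∣-trans (divides 2 refl) (subst (4 ∣_) (ℕ.*-identityʳ _) 4∣)) refl
-- With two sevens in a strip, the number of wide arrays is twice the number of 3-row strips, and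
-- one factor 2 cancels from 4.
heffterSet′ c x s₄ 0<c (width₂ y) =
  withSevens c x s₄ 2 y 2 (2 + y) _ 0<c (s≤s z≤n) refl (*-cancelʳ-∣ 2) refl

heffterSet : ∀ {a b} c → 0 < c → Height a → Width b → Admissible (c * (a * b)) → HeffterSet a b c
heffterSet c 0<c (height₁ x) = heffterSet′ c 0 (suc x) 0<c
heffterSet c 0<c (height₃ x) = heffterSet′ c 1 x 0<c

-- Reduction by the greatest common divisor

private
  rearrange : ∀ c t g a → c * t * (g * a) ≡ c * (a * (g * t))
  rearrange = solve-∀

heffter : ∀ a t g h → 0 < g → ¬ (2 ∣ a) → 7 ≤ a → 3 ≤ g * t → g * t ∉ 3 ∷ 5 ∷ 6 ∷ 10 ∷ [] →
          Admissible ((g + h) * t * (g * a)) → H ((g + h) * a) ((g + h) * t) (g * t) (g * a)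
heffter a t g@(suc _) h 0<g odd 7≤a 3≤b b∉ ok
  with As , _ , covers ← heffterSet (g + h) (s≤s z≤n) (height a odd 7≤a) (width (g * t) 3≤b b∉)
                           (subst Admissible (rearrange (g + h) t g a) ok)
  = record { array = placed {g = g} {h = h} As ; isHeffter = placed-isHeffter {g = g} {h = h} As covers }

-- Cancelling g leaves m t = n a, so a divides m with some cofactor c, and n = c t. Then s ≤ n reads
-- t g ≤ c t, which gives g ≤ c; h is the excess of c over g.
reduced : ∀ m n a t g → 0 < g → Coprime a t → m * (t * g) ≡ n * (a * g) → t * g ≤ n →
          3 ≤ t * g → 7 ≤ a → ∃ λ h → m ≡ (g + h) * a × n ≡ (g + h) * t
reduced m n a@(suc _) t@(suc _) g@(suc _) _ coprime eq tg≤n _ _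
  = from-divisor (coprime-divisor {o = m} coprime (divides n (trans (ℕ.*-comm t m) mt≡na)))
  where
  mt≡na : m * t ≡ n * a
  mt≡na = ℕ.*-cancelʳ-≡ (m * t) (n * a) g
    (trans (ℕ.*-assoc m t g) (trans eq (sym (ℕ.*-assoc n a g))))
  swap : ∀ c a t → c * a * t ≡ c * t * a
  swap = solve-∀
  from-divisor : a ∣ m → ∃ λ h → m ≡ (g + h) * a × n ≡ (g + h) * t
  from-divisor (divides c m≡ca) =
    let h , g+h≡c = ℕ.m≤n⇒∃[o]m+o≡n (ℕ.*-cancelʳ-≤ g c t (subst₂ _≤_ (ℕ.*-comm t g) n≡ct tg≤n)) in
    h , trans m≡ca (cong (_* a) (sym g+h≡c)) , trans n≡ct (cong (_* t) (sym g+h≡c))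
    where
    n≡ct : n ≡ c * t
    n≡ct = ℕ.*-cancelʳ-≡ n (c * t) a (trans (sym mt≡na) (trans (cong (_* t) m≡ca) (swap c a t)))

mainTheorem1 : (m n s k : ℕ) →
    3 ≤ s → s ≤ n →
    3 ≤ k → k ≤ m →
    m * s ≡ n * k →
    (n * k) % 4 ≡ 0 ⊎ (n * k) % 4 ≡ 3 →
    ¬ (2 ∣ k) →
    k ≥ 7 * gcd k s →
    s ∉ 3 ∷ 5 ∷ 6 ∷ 10 ∷ [] →
    H m n s k
mainTheorem1 m n s k 3≤s s≤n 3≤k _ ms≡nk ok odd k≥7g s∉
  with divides a k≡ ← gcd[m,n]∣m k s | divides t s≡ ← gcd[m,n]∣n k s
  = construct (gcd k s) a t 0<g gcd-greatest k≡ s≡ k≥7g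
  where
  0<g : 0 < gcd k s
  0<g = ℕ.n≢0⇒n>0 (gcd[m,n]≢0 k s (inj₁ λ { refl → contradiction 3≤k λ () }))
  -- The gcd is generalised to a variable g with its universal property, so that k and s can be
  -- replaced by a g and t g.
  construct : ∀ g a t → 0 < g → (∀ {d} → d ∣ k → d ∣ s → d ∣ g) → k ≡ a * g → s ≡ t * g → k ≥ 7 * g → H m n s k
  construct g@(suc _) a t 0<g greatest refl refl k≥7g = place (reduced m n a t g 0<g coprime ms≡nk s≤n 3≤s 7≤a)
    where
    7≤a : 7 ≤ a
    7≤a = ℕ.*-cancelʳ-≤ 7 a g k≥7g
    coprime : Coprime a t
    -- If d divides a and t, then d g divides k and s, hence g, and d = 1.
    coprime {d} (d∣a , d∣t) = ∣1⇒≡1 (*-cancelʳ-∣ g (subst (d * g ∣_) (sym (ℕ.*-identityˡ g))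
      (greatest (*-monoˡ-∣ g d∣a) (*-monoˡ-∣ g d∣t))))
    place : (∃ λ h → m ≡ (g + h) * a × n ≡ (g + h) * t) → H m n (t * g) (a * g)
    place (h , m≡ , n≡) = subst₂ (λ m n → H m n (t * g) (a * g)) (sym m≡) (sym n≡)
      (subst₂ (H ((g + h) * a) ((g + h) * t)) (ℕ.*-comm g t) (ℕ.*-comm g a)
        (heffter a t g h 0<g (odd ∘ ∣m⇒∣m*n g) 7≤a (subst (3 ≤_) (ℕ.*-comm t g) 3≤s)
          (subst (_∉ 3 ∷ 5 ∷ 6 ∷ 10 ∷ []) (ℕ.*-comm t g) s∉)
          (subst₂ (λ n k → Admissible (n * k)) n≡ (ℕ.*-comm a g) ok)))
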